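{- Let $k,n$ be integers with $k\ge1$, $n\ge2$, let $F$ be an oriented tree of order $n$, and let $D$ be a $k$-extension of $F$. Then $\mathrm{unv}(D)\le 3^{\binom{2k+2}{2}}\cdot \mathrm{unv}^*(F)$.
   Context: A digraph is $p$-unavoidable if it is contained in (isomorphic to a subdigraph of) every tournament of order $p$; for an acyclic digraph $D$, $\mathrm{unv}(D)$ is the least such $p$. For an acyclic digraph $D$, $\mathrm{unv}^*(D)$ is the maximum of $\mathrm{unv}(H)+|V(D)\setminus V(H)|$ over all subdigraphs $H$ of $D$. An oriented tree is an orientation of a tree. For an acyclic digraph $A$ and positive integer $k$, an acyclic digraph $D$ is a $k$-extension of $A$ if there is a set $S$ of $k$ vertices of $D$ with $D-S=A$. -}

module Defs where

open import Data.Nat using (ℕ; zero; suc; _+_; _∸_; _≤_)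
open import Data.Fin using (Fin; zero; suc)
open import Data.Bool using (Bool; true; false; not; if_then_else_)
open import Data.Product using (Σ; _×_; _,_; ∃)
open import Data.Sum using (_⊎_)
open import Relation.Binary.PropositionalEquality using (_≡_; _≢_)
open import Relation.Nullary using (¬_)
open import Function.Definitions using (Injective)

Digraph : ℕ → Set
Digraph n = Fin n → Fin n → Bool

data Reach {n : ℕ} (D : Digraph n) : Fin n → Fin n → Set where
  step : ∀ {u v} → D u v ≡ true → Reach D u v
  _∷_  : ∀ {u v w} → D u v ≡ true → Reach D v w → Reach D u w

Acyclic : ∀ {n} → Digraph n → Set
Acyclic D = ∀ v → ¬ Reach D v v

Tournament : ∀ {p} → Digraph p → Set
Tournament T = (∀ i → T i i ≡ false) × (∀ i j → i ≢ j → T i j ≡ not (T j i))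

Contains : ∀ {m n} → Digraph n → Digraph m → Set
Contains {m} {n} D H =
  Σ (Fin m → Fin n) λ f → Injective _≡_ _≡_ f × (∀ u v → H u v ≡ true → D (f u) (f v) ≡ true)

Unavoidable : ℕ → ∀ {m} → Digraph m → Set
Unavoidable p D = (T : Digraph p) → Tournament T → Contains T D

IsUnv : ∀ {m} → Digraph m → ℕ → Set
IsUnv D u = Unavoidable u D × (∀ q → Unavoidable q D → u ≤ q)

-- unv*(D) = s : s is the maximum of unv(H) + |V(D) \ V(H)| over subdigraphs H
-- of D (subdigraphs taken up to isomorphism, i.e. H on m vertices contained in D).
IsUnvStar : ∀ {n} → Digraph n → ℕ → Set
IsUnvStar {n} D s =
  (∀ m (H : Digraph m) → Contains D H → ∀ u → IsUnv H u → u + (n ∸ m) ≤ s)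
  × (Σ ℕ λ m → Σ (Digraph m) λ H → Contains D H × Σ ℕ λ u → IsUnv H u × u + (n ∸ m) ≡ s)

sumFin : ∀ n → (Fin n → ℕ) → ℕ
sumFin zero    f = 0
sumFin (suc n) f = f zero + sumFin n (λ i → f (suc i))

arcCount : ∀ {n} → Digraph n → ℕ
arcCount {n} D = sumFin n λ u → sumFin n λ v → if D u v then 1 else 0

data UWalk {n : ℕ} (D : Digraph n) : Fin n → Fin n → Set where
  here : ∀ {u} → UWalk D u u
  fwd  : ∀ {u v w} → D u v ≡ true → UWalk D v w → UWalk D u w
  bwd  : ∀ {u v w} → D v u ≡ true → UWalk D v w → UWalk D u w

-- Oriented tree: an orientation (no loops, no pair of opposite arcs) whose
-- underlying graph is a tree (connected with n - 1 edges).
OrientedTree : ∀ {n} → Digraph n → Set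
OrientedTree {n} F =
  (∀ v → F v v ≡ false)
  × (∀ u v → F u v ≡ true → F v u ≡ false)
  × (∀ u v → UWalk F u v)
  × (arcCount F ≡ n ∸ 1)

-- D (on n + k vertices) is a k-extension of A (on n vertices): D is acyclic and
-- deleting a set S of k vertices leaves A, i.e. there is an injection e of V(A)
-- into V(D) (whose image is the complement of S) along which arcs agree exactly.
IsExtension : ∀ {n} k → Digraph n → Digraph (n + k) → Set
IsExtension {n} k A D =
  Acyclic D × Σ (Fin n → Fin (n + k)) λ e →
    Injective _≡_ _≡_ e × (∀ u v → D (e u) (e v) ≡ A u v)

{-# OPTIONS --safe #-}
-- Remove from D the k added vertices and cut a linear extension of D at them: the
-- vertices of the tree F fall into k + 1 classes. Repeatedly passing to a third of the
-- vertices shows that a tournament T of order N = 3 ^ (2k+2 choose 2) · s has more than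
-- s · N ^ 2k transitive (2k+1)-tuples w₀ t₁ w₁ … t_k w_k. Fix t₁ … t_k contained in more
-- than s · N ^ k of them, and delete, as long as possible, every vertex of a class of
-- candidates for some wᵢ having fewer than s neighbours in the right direction among the
-- candidates for some wⱼ. The candidate classes being disjoint, some tuple survives.
-- The tree is then embedded one component of a class at a time: a new component is attached
-- to what is already embedded by a single arc, so it may go anywhere in the neighbourhood
-- of one vertex; this has s vertices, enough by definition of unv* even after discarding
-- the used ones.

module Submission where

open import Defs
open import Data.Nat using (ℕ; zero; suc; _+_; _*_; _∸_; _^_; _≤_; _<_; z≤n; s≤s; s≤s⁻¹;
  _≤?_; _<?_; _<ᵇ_; >-nonZero)
open import Data.Nat.Properties hiding (_≟_)
open import Data.Nat.Combinatorics using (_C_; nC1≡n; nCk+nC[k+1]≡[n+1]C[k+1])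
open import Data.Nat.Tactic.RingSolver using (solve-∀)
import Data.Bool as Bool
open import Data.Bool using (Bool; true; false; not; if_then_else_; _∧_; _∨_)
open import Data.Bool.Properties using (∧-conicalˡ; ∧-conicalʳ; ∧-identityʳ; ∨-zeroʳ) renaming (_≟_ to _≟ᵇ_)
open import Data.Nat.Induction using (Acc; acc; <-wellFounded)
open import Data.Fin using (Fin; zero; suc; toℕ; fromℕ<; inject≤; _≟_)
open import Data.Fin.Properties using (any?; all?; toℕ-injective; toℕ-fromℕ<; toℕ<n; inject≤-injective)
  renaming (suc-injective to Fin-suc-injective)
open import Data.Vec using (Vec; []; _∷_; lookup; tabulate)
open import Data.Vec.Properties using (lookup∘tabulate)
open import Data.Product using (∃; ∃₂; _×_; _,_; proj₁; proj₂)
open import Data.Sum using (_⊎_; inj₁; inj₂)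
open import Data.Empty using (⊥; ⊥-elim)
open import Function using (_∘_; case_of_)
open import Function.Definitions using (Injective)
open import Relation.Nullary using (¬_; Dec; yes; no; does; contradiction)
open import Relation.Nullary.Decidable using (map′; dec-true; dec-false; decidable-stable;
  ¬¬-excluded-middle; ¬?; _×-dec_; _⊎-dec_; _→-dec_)
open import Relation.Binary.PropositionalEquality
  using (_≡_; _≢_; refl; sym; trans; cong; cong₂; subst; subst₂)
open import Relation.Binary.Definitions using (tri<; tri≈; tri>)
import Algebra.Properties.Semiring.Sum +-*-semiring as Sum

private
  variable
    n N m k s : ℕ

-- Finite sums and cardinalities of Boolean subsets

-- Opaque, so that unification does not unfold it.
opaque

  sum : (Fin n → ℕ) → ℕ
  sum = Sum.sum

  sum-[] : (f : Fin 0 → ℕ) → sum f ≡ 0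
  sum-[] f = refl

  sum-suc : (f : Fin (suc n) → ℕ) → sum f ≡ f zero + sum (f ∘ suc)
  sum-suc f = refl

  sum-cong : {f g : Fin n → ℕ} → (∀ i → f i ≡ g i) → sum f ≡ sum g
  sum-cong = Sum.sum-cong-≗

  sum-+ : (f g : Fin n → ℕ) → sum (λ i → f i + g i) ≡ sum f + sum g
  sum-+ = Sum.∑-distrib-+

  sum-comm : (f : Fin m → Fin n → ℕ) → sum (λ i → sum (f i)) ≡ sum (λ j → sum (λ i → f i j))
  sum-comm = Sum.∑-comm

  sum-distribˡ : (c : ℕ) (f : Fin n → ℕ) → sum (λ i → c * f i) ≡ c * sum f
  sum-distribˡ c f = sym (Sum.*-distribˡ-sum c f)

  sumFin≡sum : ∀ n (f : Fin n → ℕ) → sumFin n f ≡ sum f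
  sumFin≡sum zero    f = refl
  sumFin≡sum (suc n) f = cong (f zero +_) (sumFin≡sum n (f ∘ suc))

  sum-mono : (f g : Fin n → ℕ) → (∀ i → f i ≤ g i) → sum f ≤ sum g
  sum-mono {zero}  f g f≤g = z≤n
  sum-mono {suc n} f g f≤g = +-mono-≤ (f≤g zero) (sum-mono (f ∘ suc) (g ∘ suc) (f≤g ∘ suc))

  sum-const : ∀ n c → sum {n} (λ _ → c) ≡ n * c
  sum-const zero    c = refl
  sum-const (suc n) c = cong (c +_) (sum-const n c)

  sum-term : (f : Fin n → ℕ) (i : Fin n) → f i ≤ sum f
  sum-term f zero    = m≤m+n _ _
  sum-term f (suc i) = ≤-trans (sum-term (f ∘ suc) i) (m≤n+m _ _)

sum-distribʳ : (c : ℕ) (f : Fin n → ℕ) → sum (λ i → f i * c) ≡ sum f * c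
sum-distribʳ c f =
  trans (sum-cong (λ i → *-comm (f i) c)) (trans (sum-distribˡ c f) (*-comm c (sum f)))

sum≤1⇒unique : (f : Fin n → ℕ) → sum f ≤ 1 → ∀ {i j} → 1 ≤ f i → 1 ≤ f j → i ≡ j
sum≤1⇒unique {suc n} f f≤1 = go (≤-trans (≤-reflexive (sym (sum-suc f))) f≤1)
  where
  rest : ℕ
  rest = sum (f ∘ suc)
  go : f zero + rest ≤ 1 → ∀ {i j} → 1 ≤ f i → 1 ≤ f j → i ≡ j
  go le {zero}  {zero}  p q = refl
  go le {zero}  {suc j} p q = contradiction (≤-trans (+-mono-≤ p (≤-trans q (sum-term (f ∘ suc) j))) le) λ { (s≤s ()) }
  go le {suc i} {zero}  p q = contradiction (≤-trans (+-mono-≤ q (≤-trans p (sum-term (f ∘ suc) i))) le) λ { (s≤s ()) }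
  go le {suc i} {suc j} p q = cong suc (sum≤1⇒unique (f ∘ suc) (m+n≤o⇒n≤o (f zero) le) p q)

sum-pigeonhole : ∀ N K (f : Fin N → ℕ) → N * K < sum f → ∃ λ i → K < f i
sum-pigeonhole N K f NK<f with any? (λ i → K <? f i)
... | yes p = p
... | no ¬p = contradiction
  (≤-trans (sum-mono f (λ _ → K) (λ i → ≮⇒≥ (λ K<fi → ¬p (i , K<fi)))) (≤-reflexive (sum-const N K)))
  (<⇒≱ NK<f)

does⁻ : {A : Set} (a? : Dec A) → does a? ≡ true → A
does⁻ (yes a) _ = a

does-false⁻ : {A : Set} (a? : Dec A) → does a? ≡ false → ¬ A
does-false⁻ (no ¬a) _ = ¬a

not⁻ : ∀ {b} → not b ≡ true → b ≡ false
not⁻ {false} _ = refl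

¬false : ∀ {b} → b ≢ false → b ≡ true
¬false {true}  _ = refl
¬false {false} p = contradiction refl p

∧-true : ∀ {a b} → a ≡ true → b ≡ true → a ∧ b ≡ true
∧-true refl refl = refl

∧ˡ : ∀ {a b} → a ∧ b ≡ true → a ≡ true
∧ˡ {a} {b} = ∧-conicalˡ a b

∧ʳ : ∀ {a b} → a ∧ b ≡ true → b ≡ true
∧ʳ {a} {b} = ∧-conicalʳ a b

true≢false : ∀ {b} {A : Set} → b ≡ true → b ≡ false → A
true≢false refl ()

χ : Bool → ℕ
χ b = if b then 1 else 0

χ≤1 : ∀ b → χ b ≤ 1
χ≤1 false = z≤n
χ≤1 true  = ≤-refl

χ-true : ∀ {b} → b ≡ true → 1 ≤ χ b
χ-true refl = ≤-refl

χ-mono : ∀ {a b} → (a ≡ true → b ≡ true) → χ a ≤ χ b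
χ-mono {false} a⇒b = z≤n
χ-mono {true}  a⇒b = χ-true (a⇒b refl)

χ-∧ : ∀ a b → χ (a ∧ b) ≡ χ a * χ b
χ-∧ false b = refl
χ-∧ true  b = sym (+-identityʳ (χ b))

χ-bound : ∀ b {m} → (b ≡ true → 1 ≤ m) → χ b ≤ m
χ-bound false h = z≤n
χ-bound true  h = h refl

χ-positive : ∀ b → 0 < χ b → b ≡ true
χ-positive true _ = refl

SubsetOf : ℕ → Set
SubsetOf n = Fin n → Bool

infixr 6 _∩_
infixr 5 _∪_
infixl 7 _∖_

_∩_ _∪_ : SubsetOf n → SubsetOf n → SubsetOf n
(A ∩ B) x = A x ∧ B x
(A ∪ B) x = A x ∨ B x

⁅_⁆ : Fin n → SubsetOf n
⁅ x ⁆ y = does (x ≟ y)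

_∖_ : SubsetOf n → Fin n → SubsetOf n
(A ∖ x) y = A y ∧ not (⁅ x ⁆ y)

full : SubsetOf n
full _ = true

card : SubsetOf n → ℕ
card A = sum (χ ∘ A)

card-mono : (A B : SubsetOf n) → (∀ x → A x ≡ true → B x ≡ true) → card A ≤ card B
card-mono A B A⊆B = sum-mono _ _ (λ x → χ-mono (A⊆B x))

card≤ : (A : SubsetOf n) → card A ≤ n
card≤ {n} A = ≤-trans (sum-mono _ (λ _ → 1) (χ≤1 ∘ A)) (≤-reflexive (trans (sum-const n 1) (*-identityʳ n)))

card-full : card (full {n}) ≡ n
card-full {n} = trans (sum-const n 1) (*-identityʳ n)

sum-zero : ∀ n → sum {n} (λ _ → 0) ≡ 0
sum-zero n = trans (sum-const n 0) (*-zeroʳ n)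

card-singleton : (x : Fin n) → card ⁅ x ⁆ ≡ 1
card-singleton {suc n} zero    = trans (sum-suc _) (cong suc (sum-zero n))
card-singleton {suc n} (suc x) = trans (sum-suc _) (card-singleton x)

singleton-refl : (x : Fin n) → ⁅ x ⁆ x ≡ true
singleton-refl x = dec-true (x ≟ x) refl

singleton⁻ : {x y : Fin n} → ⁅ x ⁆ y ≡ true → x ≡ y
singleton⁻ {x = x} {y} = does⁻ (x ≟ y)

sum-split : (f g h : Fin n → ℕ) → (∀ x → f x ≤ g x + h x) → sum f ≤ sum g + sum h
sum-split f g h le = ≤-trans (sum-mono f _ le) (≤-reflexive (sum-+ g h))

sum-join : (f g h : Fin n → ℕ) → (∀ x → g x + h x ≤ f x) → sum g + sum h ≤ sum f
sum-join f g h le = ≤-trans (≤-reflexive (sym (sum-+ g h))) (sum-mono _ f le)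

Disjoint : SubsetOf n → SubsetOf n → Set
Disjoint A B = ∀ x → A x ≡ true → B x ≡ false

card-∪ : (A B : SubsetOf n) → Disjoint A B → card (A ∪ B) ≡ card A + card B
card-∪ A B dis = trans (sum-cong pointwise) (sum-+ (χ ∘ A) (χ ∘ B))
  where
  pointwise : ∀ x → χ (A x ∨ B x) ≡ χ (A x) + χ (B x)
  pointwise x with A x in eq
  ... | false = refl
  ... | true rewrite dis x eq = refl

card-∖ : (A : SubsetOf n) {x : Fin n} → A x ≡ true → suc (card (A ∖ x)) ≡ card A
card-∖ A {x} Ax = trans (cong (_+ card (A ∖ x)) (sym (card-singleton x)))
  (trans (sym (sum-+ (χ ∘ ⁅ x ⁆) (χ ∘ (A ∖ x)))) (sum-cong pointwise))
  where
  pointwise : ∀ y → χ (⁅ x ⁆ y) + χ (A y ∧ not (⁅ x ⁆ y)) ≡ χ (A y)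
  pointwise y with x ≟ y | A y in eq
  ... | yes refl | true  = refl
  ... | yes refl | false = true≢false Ax eq
  ... | no _     | true  = refl
  ... | no _     | false = refl

card-strict : (A B : SubsetOf n) {x : Fin n} → (∀ y → A y ≡ true → B y ≡ true) →
  B x ≡ true → A x ≡ false → card A < card B
card-strict A B {x} A⊆B Bx ¬Ax = ≤-trans (s≤s (card-mono A (B ∖ x) A⊆B∖x)) (≤-reflexive (card-∖ B Bx))
  where
  A⊆B∖x : ∀ y → A y ≡ true → (B ∖ x) y ≡ true
  A⊆B∖x y Ay = ∧-true (A⊆B y Ay) (cong not (dec-false (x ≟ y) λ { refl → true≢false Ay ¬Ax }))

card-<n : (A : SubsetOf n) {x : Fin n} → A x ≡ false → card A < n
card-<n A ¬Ax = ≤-trans (card-strict A full (λ _ _ → refl) refl ¬Ax) (≤-reflexive card-full)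

module _ {n N : ℕ} (f : Fin n → Fin N) where

  -- Double counting of the pairs `(u , f u)` with `u` in `P`. Both bounds on images below are read
  -- off this sum.
  preimages : (P : SubsetOf n) → sum (λ y → sum (λ u → χ (P u ∧ ⁅ f u ⁆ y))) ≡ card P
  preimages P = trans (sym (sum-comm (λ u y → χ (P u ∧ ⁅ f u ⁆ y)))) (sum-cong row)
    where
    row : ∀ u → sum (λ y → χ (P u ∧ ⁅ f u ⁆ y)) ≡ χ (P u)
    row u with P u
    ... | true  = card-singleton (f u)
    ... | false = sum-zero N

  inImage? : (P : SubsetOf n) (y : Fin N) → Dec (∃ λ u → P u ≡ true × f u ≡ y)
  inImage? P y = any? (λ u → (P u ≟ᵇ true) ×-dec (f u ≟ y))

  avoidImage : SubsetOf N → SubsetOf n → SubsetOf N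
  avoidImage Y P y = Y y ∧ not (does (inImage? P y))

  card-avoidImage : ∀ Y P → card Y ≤ card (avoidImage Y P) + card P
  card-avoidImage Y P = ≤-trans (sum-split _ _ _ pointwise) (+-monoʳ-≤ _ (≤-reflexive (preimages P)))
    where
    pointwise : ∀ y → χ (Y y) ≤ χ (avoidImage Y P y) + sum (λ u → χ (P u ∧ ⁅ f u ⁆ y))
    pointwise y with inImage? P y
    ... | yes (u , Pu , refl) = ≤-trans (χ≤1 (Y y)) (≤-trans
            (χ-true (∧-true Pu (singleton-refl (f u))))
            (≤-trans (sum-term (λ u → χ (P u ∧ ⁅ f u ⁆ y)) u) (m≤n+m _ _)))
    ... | no _ = ≤-trans (χ-mono (λ Yy → ∧-true Yy refl)) (m≤m+n _ _)

  card-image : Injective _≡_ _≡_ f → n ≤ card (λ y → does (any? (λ u → f u ≟ y)))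
  card-image inj = ≤-trans (≤-reflexive (trans (sym card-full) (sym (preimages full)))) (sum-mono _ _ pointwise)
    where
    fibre≤1 : ∀ y → sum (λ u → χ (⁅ f u ⁆ y)) ≤ 1
    fibre≤1 y with any? (λ u → f u ≟ y)
    ... | yes (u , refl) = ≤-trans
            (card-mono (λ v → ⁅ f v ⁆ y) ⁅ u ⁆ (λ v p → dec-true (u ≟ v) (sym (inj (singleton⁻ p)))))
            (≤-reflexive (card-singleton u))
    ... | no ¬p = ≤-trans (≤-trans (sum-mono _ (λ _ → 0) λ u → χ-bound _ λ p → contradiction (u , singleton⁻ p) ¬p)
                    (≤-reflexive (sum-zero n))) z≤n
    pointwise : ∀ y → sum (λ u → χ (⁅ f u ⁆ y)) ≤ χ (does (any? (λ u → f u ≟ y)))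
    pointwise y with fibre≤1 y | any? (λ u → f u ≟ y)
    ... | le | yes _ = le
    ... | _  | no ¬p = ≤-trans (sum-mono _ (λ _ → 0) λ u → χ-bound _ λ p → contradiction (u , singleton⁻ p) ¬p)
                    (≤-reflexive (sum-zero n))

-- Turns a Boolean subset into some `Fin c`, so that induced subdigraphs become digraphs of the kind
-- that `Contains` and `Unavoidable` speak of.
record Enumeration {n} (A : SubsetOf n) (c : ℕ) : Set where
  field
    elem      : Fin c → Fin n
    injective : Injective _≡_ _≡_ elem
    member    : ∀ i → A (elem i) ≡ true
    complete  : ∀ x → A x ≡ true → ∃ λ i → elem i ≡ x

enumerate : (A : SubsetOf n) → Enumeration A (card A)
enumerate {zero}  A = subst (Enumeration A) (sym (sum-[] _))
  record { elem = λ () ; injective = λ { {()} } ; member = λ () ; complete = λ () }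
enumerate {suc n} A = subst (Enumeration A) (sym (sum-suc _)) (extend (A zero) refl (enumerate (A ∘ suc)))
  where
  extend : ∀ b → A zero ≡ b → ∀ {c} → Enumeration (A ∘ suc) c → Enumeration A (χ b + c)
  extend false A0 E = record
    { elem = suc ∘ elem
    ; injective = injective ∘ Fin-suc-injective
    ; member = member
    ; complete = λ { zero A0' → true≢false A0' A0
                   ; (suc x) Ax → let i , eq = complete x Ax in i , cong suc eq } }
    where open Enumeration E
  extend true A0 E = record
    { elem = λ { zero → zero ; (suc i) → suc (elem i) }
    ; injective = λ { {zero} {zero} _ → refl
                    ; {suc i} {suc j} eq → cong suc (injective (Fin-suc-injective eq)) }
    ; member = λ { zero → A0 ; (suc i) → member i }
    ; complete = λ { zero _ → zero , refl
                   ; (suc x) Ax → let i , eq = complete x Ax in suc i , cong suc eq } }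
    where open Enumeration E

-- Sums over tuples

sumV : ∀ m → (Vec (Fin N) m → ℕ) → ℕ
sumV zero    f = f []
sumV (suc m) f = sum (λ x → sumV m (λ v → f (x ∷ v)))

sumV-cong : ∀ m {f g : Vec (Fin N) m → ℕ} → (∀ v → f v ≡ g v) → sumV m f ≡ sumV m g
sumV-cong zero    eq = eq []
sumV-cong (suc m) eq = sum-cong (λ x → sumV-cong m (λ v → eq (x ∷ v)))

sumV-mono : ∀ m (f g : Vec (Fin N) m → ℕ) → (∀ v → f v ≤ g v) → sumV m f ≤ sumV m g
sumV-mono zero    f g le = le []
sumV-mono (suc m) f g le = sum-mono _ _ (λ x → sumV-mono m _ _ (λ v → le (x ∷ v)))

sumV-+ : ∀ m (f g : Vec (Fin N) m → ℕ) → sumV m (λ v → f v + g v) ≡ sumV m f + sumV m g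
sumV-+ zero    f g = refl
sumV-+ (suc m) f g = trans (sum-cong (λ x → sumV-+ m (f ∘ (x ∷_)) (g ∘ (x ∷_))))
  (sum-+ (λ x → sumV m (f ∘ (x ∷_))) (λ x → sumV m (g ∘ (x ∷_))))

sumV-distribˡ : ∀ m c (f : Vec (Fin N) m → ℕ) → sumV m (λ v → c * f v) ≡ c * sumV m f
sumV-distribˡ zero    c f = refl
sumV-distribˡ (suc m) c f = trans (sum-cong (λ x → sumV-distribˡ m c (f ∘ (x ∷_))))
  (sum-distribˡ c (λ x → sumV m (f ∘ (x ∷_))))

sumV-comm : ∀ m (f : Fin n → Vec (Fin N) m → ℕ) →
  sum (λ x → sumV m (f x)) ≡ sumV m (λ v → sum (λ x → f x v))
sumV-comm zero    f = refl
sumV-comm (suc m) f = trans (sum-comm (λ x y → sumV m (f x ∘ (y ∷_))))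
  (sum-cong (λ y → sumV-comm m (λ x v → f x (y ∷ v))))

sumV-const : ∀ m c → sumV {N} m (λ _ → c) ≡ c * N ^ m
sumV-const zero c = sym (*-identityʳ c)
sumV-const {N} (suc m) c = trans (sum-const N _) (trans (cong (N *_) (sumV-const {N} m c)) (lemma N c (N ^ m)))
  where
  lemma : ∀ a b c → a * (b * c) ≡ b * (a * c)
  lemma = solve-∀

sumV-pigeonhole : ∀ m K (f : Vec (Fin N) m → ℕ) → N ^ m * K < sumV m f → ∃ λ v → K < f v
sumV-pigeonhole zero K f lt = [] , subst (_< f []) (+-identityʳ K) lt
sumV-pigeonhole {N} (suc m) K f lt
  with x , lt′ ← sum-pigeonhole N (N ^ m * K) (λ x → sumV m (f ∘ (x ∷_))) (subst (_< sumV (suc m) f) (*-assoc N (N ^ m) K) lt)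
  with v , lt″ ← sumV-pigeonhole m K (λ v → f (x ∷ v)) lt′ = x ∷ v , lt″

sumV-lookup : ∀ q (g : Fin N → ℕ) (i : Fin (suc q)) → sumV (suc q) (λ v → g (lookup v i)) ≡ sum g * N ^ q
sumV-lookup {N} q g zero = trans (sum-cong (λ x → sumV-const {N} q (g x))) (sum-distribʳ (N ^ q) g)
sumV-lookup {N} (suc q) g (suc i) =
  trans (sum-const N _) (trans (cong (N *_) (sumV-lookup q g i)) (lemma N (sum g) (N ^ q)))
  where
  lemma : ∀ a b c → a * (b * c) ≡ b * (a * c)
  lemma = solve-∀

-- For the indicators of two vertex sets this counts the tuples with entry `i` in the first set and
-- entry `j` in the second; the other `q` entries are free. It is the price of one deletion in the
-- cleaning below.
sumV-lookup₂ : ∀ q (f g : Fin N → ℕ) {i j : Fin (suc (suc q))} → i ≢ j →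
  sumV (suc (suc q)) (λ v → f (lookup v i) * g (lookup v j)) ≡ sum f * sum g * N ^ q
sumV-lookup₂ q f g {zero} {zero} i≢j = contradiction refl i≢j
sumV-lookup₂ {N} q f g {zero} {suc j} i≢j =
  trans (sum-cong (λ x → trans (sumV-distribˡ (suc q) (f x) (λ v → g (lookup v j))) (cong (f x *_) (sumV-lookup q g j))))
        (trans (sum-distribʳ _ f) (sym (*-assoc (sum f) (sum g) (N ^ q))))
sumV-lookup₂ {N} q f g {suc i} {zero} i≢j =
  trans (sum-cong (λ x → trans (sumV-cong (suc q) (λ v → *-comm (f (lookup v i)) (g x)))
          (trans (sumV-distribˡ (suc q) (g x) (λ v → f (lookup v i))) (cong (g x *_) (sumV-lookup q f i)))))
        (trans (sum-distribʳ _ g) (lemma (sum f) (sum g) (N ^ q)))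
  where
  lemma : ∀ a b c → b * (a * c) ≡ a * b * c
  lemma = solve-∀
sumV-lookup₂ zero f g {suc zero} {suc zero} i≢j = contradiction refl i≢j
sumV-lookup₂ {N} (suc q) f g {suc i} {suc j} i≢j =
  trans (sum-const N _) (trans (cong (N *_) (sumV-lookup₂ q f g (i≢j ∘ cong suc)))
    (lemma N (sum f) (sum g) (N ^ q)))
  where
  lemma : ∀ a b c d → a * (b * c * d) ≡ b * c * (a * d)
  lemma = solve-∀

*-distrib-^ : ∀ a b m → (a * b) ^ m ≡ a ^ m * b ^ m
*-distrib-^ a b zero    = refl
*-distrib-^ a b (suc m) = trans (cong (a * b *_) (*-distrib-^ a b m)) (lemma a b (a ^ m) (b ^ m))
  where
  lemma : ∀ a b c d → a * b * (c * d) ≡ a * c * (b * d)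
  lemma = solve-∀

choose-suc : ∀ m → suc m C 2 ≡ m + m C 2
choose-suc m = trans (sym (nCk+nC[k+1]≡[n+1]C[k+1] m 1)) (cong (_+ m C 2) (nC1≡n m))

-- Counting transitive subtournaments

module Chains {N} (T : Digraph N) (tournament : Tournament T) where

  loopless : ∀ x → T x x ≡ false
  loopless = proj₁ tournament

  asymmetric : ∀ {x y} → T x y ≡ true → T y x ≡ true → ⊥
  asymmetric {x} {y} xy yx with x ≟ y
  ... | yes refl = true≢false xy (loopless x)
  ... | no x≢y   = true≢false xy (trans (proj₂ tournament x y x≢y) (cong not yx))

  semiconnex : ∀ x y → x ≢ y → T x y ≡ true ⊎ T y x ≡ true
  semiconnex x y x≢y with T y x in eq
  ... | true  = inj₂ refl
  ... | false = inj₁ (trans (proj₂ tournament x y x≢y) (cong not eq))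

  out : SubsetOf N → Fin N → SubsetOf N
  out A x = A ∩ T x

  -- B has |B|(|B|-1)/2 arcs, but fewer than |B| d of them.
  few-low-degree : (B : SubsetOf N) (d : ℕ) → 0 < d →
    (∀ x → B x ≡ true → card (out B x) < d) → card B < 2 * d
  few-low-degree B d 0<d low = conclude (card B) refl
    where
    b arcs : ℕ
    b    = card B
    arcs = sum (λ x → χ (B x) * card (out B x))

    arcs-double : arcs ≡ sum (λ x → sum (λ y → χ (B x) * χ (out B x y)))
    arcs-double = sum-cong (λ x → sym (sum-distribˡ (χ (B x)) _))

    -- Two vertices of `B` coincide or are joined by an arc one way or the other. Summed over all
    -- pairs this gives `squares`.
    pointwise : ∀ x y → χ (B x) * χ (B y) ≤
      (χ (B x) * χ (out B x y) + χ (B y) * χ (out B y x)) + χ (B x) * χ (⁅ x ⁆ y)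
    pointwise x y with B x | B y
    ... | false | _     = z≤n
    ... | true  | false = z≤n
    ... | true  | true with x ≟ y
    ... | yes refl = m≤n+m 1 _
    ... | no x≢y with semiconnex x y x≢y
    ... | inj₁ xy rewrite xy = s≤s z≤n
    ... | inj₂ yx rewrite yx = ≤-trans (m≤n+m 1 _) (m≤m+n _ 0)

    squares : b * b ≤ (arcs + arcs) + b
    squares = ≤-trans (≤-reflexive (sym (trans (sum-cong (λ x → sum-distribˡ (χ (B x)) _)) (sum-distribʳ b _))))
      (≤-trans (sum-split _ _ _ λ x → sum-split _ _ _ (pointwise x))
        (+-mono-≤ (≤-trans (sum-split _ _ _ λ x → sum-split _ _ _ λ y → ≤-refl)
                     (+-mono-≤ (≤-reflexive (sym arcs-double))
                       (≤-reflexive (trans (sum-comm _) (sym arcs-double)))))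
          (≤-reflexive (sum-cong λ x → trans (sum-distribˡ (χ (B x)) _)
             (trans (cong (χ (B x) *_) (card-singleton x)) (*-identityʳ _))))))

    arcs-bound : arcs + b ≤ b * d
    arcs-bound = ≤-trans (sum-join _ _ _ row) (≤-reflexive (sum-distribʳ d _))
      where
      row : ∀ x → χ (B x) * card (out B x) + χ (B x) ≤ χ (B x) * d
      row x with B x in eq
      ... | false = z≤n
      ... | true  = ≤-trans (≤-reflexive (lemma (card (out B x)))) (≤-trans (low x eq) (m≤m+n d 0))
        where
        lemma : ∀ c → c + 0 + 1 ≡ suc c
        lemma = solve-∀

    -- Together the bounds give `b * suc b ≤ b * (2 * d)`. Here `b` cancels unless it is 0, where
    -- `0 < d` settles the claim.
    conclude : ∀ c → card B ≡ c → c < 2 * d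
    conclude zero    _  = ≤-trans 0<d (m≤m+n d _)
    conclude (suc c) eq = *-cancelˡ-≤ (suc c) (subst (λ c → c * suc c ≤ c * (2 * d)) eq total)
      where
      rearrange₁ : ∀ a b → a + a + b + b ≡ (a + b) + (a + b)
      rearrange₁ = solve-∀
      rearrange₂ : ∀ b d → b * d + b * d ≡ b * (2 * d)
      rearrange₂ = solve-∀
      total : b * suc b ≤ b * (2 * d)
      total = ≤-trans (≤-reflexive (trans (*-suc b b) (+-comm b (b * b))))
        (≤-trans (+-monoˡ-≤ b squares)
        (≤-trans (≤-reflexive (rearrange₁ arcs b))
        (≤-trans (+-mono-≤ arcs-bound arcs-bound) (≤-reflexive (rearrange₂ b d)))))

  highDegree : SubsetOf N → ℕ → SubsetOf N
  highDegree A d x = A x ∧ does (d ≤? card (out A x))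

  -- The vertices left out have fewer than `d` out-neighbours among themselves, so there are fewer
  -- than `2 * d` of them, out of at least `3 * d`.
  many-high-degree : (A : SubsetOf N) (d : ℕ) → 0 < d → 3 * d ≤ card A → d < card (highDegree A d)
  many-high-degree A d 0<d 3d≤A = +-cancelˡ-< (2 * d) d _ (≤-trans (s≤s (≤-trans (≤-reflexive (lemma d)) 3d≤A))
    (≤-trans (s≤s (sum-split _ (χ ∘ low) (χ ∘ highDegree A d) pointwise)) (+-monoˡ-≤ _ low-small)))
    where
    lemma : ∀ d → 2 * d + d ≡ 3 * d
    lemma = solve-∀
    low : SubsetOf N
    low x = A x ∧ not (does (d ≤? card (out A x)))
    pointwise : ∀ x → χ (A x) ≤ χ (low x) + χ (highDegree A d x)
    pointwise x with A x | does (d ≤? card (out A x))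
    ... | false | _     = z≤n
    ... | true  | true  = ≤-refl
    ... | true  | false = ≤-refl
    low-small : card low < 2 * d
    low-small = few-low-degree low d 0<d λ x lowx →
      ≤-<-trans (card-mono (out low x) (out A x) (λ y p → ∧-true (∧ˡ (∧ˡ p)) (∧ʳ {low y} p)))
                (≰⇒> (does-false⁻ (d ≤? _) (not⁻ (∧ʳ {A x} lowx))))

  -- Each vertex shrinks the candidates for the later ones to its own out-neighbours, so a chain is
  -- a transitive subtournament listed from source to sink.
  chain : SubsetOf N → Vec (Fin N) m → Bool
  chain A []       = true
  chain A (x ∷ xs) = A x ∧ chain (out A x) xs

  chains : ℕ → SubsetOf N → ℕ
  chains m A = sumV m (χ ∘ chain A)

  -- Only chains starting at a vertex of high degree are counted. The factor `c` stands on the side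
  -- of the chains to avoid division.
  chains-suc : ∀ m A d c g → (∀ x → d ≤ card (out A x) → g ≤ c * chains m (out A x)) →
    card (highDegree A d) * g ≤ c * chains (suc m) A
  chains-suc m A d c g bound = ≤-trans (≤-reflexive (sym (sum-distribʳ g _)))
    (≤-trans (sum-mono _ _ (λ x → guard (A x) (d ≤? _) (bound x)))
      (≤-reflexive (trans (sum-cong factor) (sum-distribˡ c _))))
    where
    exchange : ∀ a b c → a * (b * c) ≡ b * (a * c)
    exchange = solve-∀
    factor : ∀ x → χ (A x) * (c * chains m (out A x)) ≡ c * sumV m (λ v → χ (chain A (x ∷ v)))
    factor x = trans (exchange (χ (A x)) c _)
      (cong (c *_) (sym (trans (sumV-cong m λ v → χ-∧ (A x) _) (sumV-distribˡ m (χ (A x)) _))))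
    guard : ∀ b {P : Set} (p? : Dec P) {h} → (P → g ≤ h) → χ (b ∧ does p?) * g ≤ χ b * h
    guard false p?      le = z≤n
    guard true  (no _)  le = z≤n
    guard true  (yes p) le = *-monoʳ-≤ 1 (le p)

  -- Each passage to a third of the set costs a factor 3 for every vertex still to be
  -- chosen, the current one included; in all this is 3 ^ (m + 1 choose 2).
  many-chains : ∀ m r → 0 < r → (A : SubsetOf N) → 3 ^ m * r ≤ card A →
    (3 ^ m * r) ^ m ≤ 3 ^ (suc m C 2) * chains m A
  many-chains-strict : ∀ m r → 0 < r → (A : SubsetOf N) → 3 ^ suc m * r ≤ card A →
    (3 ^ suc m * r) ^ suc m < 3 ^ (suc (suc m) C 2) * chains (suc m) A

  many-chains zero    r 0<r A r≤A = ≤-refl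
  many-chains (suc m) r 0<r A r≤A = <⇒≤ (many-chains-strict m r 0<r A r≤A)

  many-chains-strict m r 0<r A r≤A = begin-strict
    (3 ^ suc m * r) ^ suc m                           ≡⟨ cong (_^ suc m) (*-assoc 3 (3 ^ m) r) ⟩
    (3 * d) ^ suc m                                   ≡⟨ *-distrib-^ 3 d (suc m) ⟩
    3 ^ suc m * (d * d ^ m)                           <⟨ *-monoʳ-< (3 ^ suc m) {{m^n≢0 3 (suc m)}}
                                                          (*-monoˡ-< (d ^ m) {{m^n≢0 d m {{>-nonZero 0<d}}}} many) ⟩
    3 ^ suc m * (h * d ^ m)                           ≤⟨ *-monoʳ-≤ (3 ^ suc m) scaled ⟩
    3 ^ suc m * (3 ^ (suc m C 2) * chains (suc m) A)  ≡⟨ *-assoc (3 ^ suc m) _ _ ⟨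
    3 ^ suc m * 3 ^ (suc m C 2) * chains (suc m) A    ≡⟨ cong (_* chains (suc m) A) (^-distribˡ-+-* 3 (suc m) (suc m C 2)) ⟨
    3 ^ (suc m + suc m C 2) * chains (suc m) A        ≡⟨ cong (λ e → 3 ^ e * chains (suc m) A) (choose-suc (suc m)) ⟨
    3 ^ (suc (suc m) C 2) * chains (suc m) A          ∎
    where
    open ≤-Reasoning
    d h : ℕ
    d = 3 ^ m * r
    h = card (highDegree A d)
    0<d : 0 < d
    0<d = *-mono-≤ (m^n>0 3 m) 0<r
    -- This surplus of first vertices makes the estimate strict; for the remaining vertices the weak
    -- bound `many-chains` is enough.
    many : d < h
    many = many-high-degree A d 0<d (≤-trans (≤-reflexive (sym (*-assoc 3 (3 ^ m) r))) r≤A)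
    scaled : h * d ^ m ≤ 3 ^ (suc m C 2) * chains (suc m) A
    scaled = chains-suc m A d (3 ^ (suc m C 2)) (d ^ m) (λ x → many-chains m r 0<r (out A x))

  -- With `r` as below, `N` is `3 ^ suc m * r`, so `N ^ suc m` is less than `3 ^ e` times the number
  -- of chains. One factor `N` on the left equals `3 ^ e * s`, and `3 ^ e` cancels.
  many-full-chains : ∀ m s → 0 < s → N ≡ 3 ^ (suc (suc m) C 2) * s → s * N ^ m < chains (suc m) full
  many-full-chains m s 0<s N≡ = *-cancelˡ-< (3 ^ e) _ _ (≤-trans (s≤s (≤-reflexive power))
      (many-chains-strict m r (*-mono-≤ (m^n>0 3 (suc m C 2)) 0<s) full (≤-reflexive (trans (sym N≡r) (sym card-full)))))
    where
    e r : ℕ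
    e = suc (suc m) C 2
    r = 3 ^ (suc m C 2) * s
    N≡r : N ≡ 3 ^ suc m * r
    N≡r = trans N≡ (trans (cong (λ e → 3 ^ e * s) (choose-suc (suc m)))
      (trans (cong (_* s) (^-distribˡ-+-* 3 (suc m) (suc m C 2))) (*-assoc (3 ^ suc m) _ s)))
    power : 3 ^ e * (s * N ^ m) ≡ (3 ^ suc m * r) ^ suc m
    power = trans (sym (*-assoc (3 ^ e) s _)) (trans (cong (_* N ^ m) (sym N≡)) (cong (_^ suc m) N≡r))

-- Splitting a chain into separators and classes

-- The number `2 * k + 1`, by recursion so that the type of `interleave` reduces along with its
-- arguments.
odd : ℕ → ℕ
odd zero    = 1
odd (suc k) = suc (suc (odd k))

interleave : Vec (Fin N) k → Vec (Fin N) (suc k) → Vec (Fin N) (odd k)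
interleave []       (w ∷ []) = w ∷ []
interleave (t ∷ ts) (w ∷ ws) = w ∷ t ∷ interleave ts ws

sumV-interleave : ∀ k (f : Vec (Fin N) (odd k) → ℕ) →
  sumV (odd k) f ≡ sumV k (λ ts → sumV (suc k) (λ ws → f (interleave ts ws)))
sumV-interleave zero    f = refl
sumV-interleave {N} (suc k) f = trans
  (sum-cong λ w → sum-cong λ t → sumV-interleave k (λ v → f (w ∷ t ∷ v)))
  (trans (sum-comm _) (sum-cong λ t →
    sumV-comm k (λ w ts → sumV (suc k) (λ ws → f (w ∷ t ∷ interleave ts ws)))))

module Separators {N} (T : Digraph N) (tournament : Tournament T) where
  open Chains T tournament

  -- Indices start at 0, and entry `j` of `ws` stands just before entry `j` of `ts`. Hence the weak
  -- inequality in `w→t` and the strict one in `t→w`.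
  record Interleaved {k} (A : SubsetOf N) (ts : Vec (Fin N) k) (ws : Vec (Fin N) (suc k)) : Set where
    field
      ts∈A : ∀ l → A (lookup ts l) ≡ true
      ws∈A : ∀ j → A (lookup ws j) ≡ true
      t→t  : ∀ l l′ → toℕ l < toℕ l′ → T (lookup ts l) (lookup ts l′) ≡ true
      w→w  : ∀ j j′ → toℕ j < toℕ j′ → T (lookup ws j) (lookup ws j′) ≡ true
      t→w  : ∀ l j → toℕ l < toℕ j → T (lookup ts l) (lookup ws j) ≡ true
      w→t  : ∀ j l → toℕ j ≤ toℕ l → T (lookup ws j) (lookup ts l) ≡ true

  -- The membership fields drive the induction: for the tail, `A` becomes the set of its common
  -- out-neighbours of `w` and `t`, so membership there supplies the arcs from `w` and `t`.
  chain⇒Interleaved : ∀ A (ts : Vec (Fin N) k) ws → chain A (interleave ts ws) ≡ true → Interleaved A ts ws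
  chain⇒Interleaved A [] (w ∷ []) p = record
    { ts∈A = λ () ; ws∈A = λ { zero → ∧ˡ p } ; t→t = λ ()
    ; w→w = λ { zero zero () } ; t→w = λ () ; w→t = λ { _ () } }
  chain⇒Interleaved A (t ∷ ts) (w ∷ ws) p = record
    { ts∈A = λ { zero → ∧ˡ wt ; (suc l) → ∧ˡ (∧ˡ (I.ts∈A l)) }
    ; ws∈A = λ { zero → ∧ˡ p ; (suc j) → ∧ˡ (∧ˡ (I.ws∈A j)) }
    ; t→t = λ { zero zero () ; zero (suc l) _ → ∧ʳ {out A w _} (I.ts∈A l) ; (suc l) (suc l′) (s≤s lt) → I.t→t l l′ lt }
    ; w→w = λ { zero zero () ; zero (suc j) _ → ∧ʳ {A _} (∧ˡ (I.ws∈A j)) ; (suc j) (suc j′) (s≤s lt) → I.w→w j j′ lt }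
    ; t→w = λ { zero (suc j) _ → ∧ʳ {out A w _} (I.ws∈A j) ; (suc l) (suc j) (s≤s lt) → I.t→w l j lt }
    ; w→t = λ { zero zero _ → ∧ʳ {A _} wt ; zero (suc l) _ → ∧ʳ {A _} (∧ˡ (I.ts∈A l))
              ; (suc j) (suc l) (s≤s le) → I.w→t j l le } }
    where
    q : chain (out A w) (t ∷ interleave ts ws) ≡ true
    q = ∧ʳ {A w} p
    wt : out A w t ≡ true
    wt = ∧ˡ q
    module I = Interleaved (chain⇒Interleaved (out (out A w) t) ts ws (∧ʳ {out A w t} q))

  -- An arc in the direction prescribed by the positions i and j; for i ≥ j it goes backwards.
  arc : ℕ → ℕ → Fin N → Fin N → Bool
  arc i j x y = if i <ᵇ j then T x y else T y x

  arc-< : ∀ {i j x y} → i < j → arc i j x y ≡ T x y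
  arc-< {i} {j} i<j with i <ᵇ j | <⇒<ᵇ i<j
  ... | true | _ = refl

  arc-≥ : ∀ {i j x y} → j ≤ i → arc i j x y ≡ T y x
  arc-≥ {i} {j} j≤i with i <ᵇ j in eq
  ... | true  = contradiction (<ᵇ⇒< i j (subst Bool.T (sym eq) _)) (≤⇒≯ j≤i)
  ... | false = refl

  arc⇒≢ : ∀ i j {x y} → arc i j x y ≡ true → x ≢ y
  arc⇒≢ i j p refl with i <ᵇ j
  ... | true  = true≢false p (loopless _)
  ... | false = true≢false p (loopless _)

  module Classes {k} (ts : Vec (Fin N) k) where

    -- A vertex of class `j` is dominated by the first `j` separators and dominates all others, so
    -- it fits between separators number `j - 1` and `j`.
    inClass? : (j : Fin (suc k)) (x : Fin N) → Dec (∀ l → arc (toℕ l) (toℕ j) (lookup ts l) x ≡ true)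
    inClass? j x = all? (λ l → arc (toℕ l) (toℕ j) (lookup ts l) x ≟ᵇ true)

    Class : Fin (suc k) → SubsetOf N
    Class j x = does (inClass? j x)

    Class⁻ : ∀ {j x} → Class j x ≡ true → ∀ l → arc (toℕ l) (toℕ j) (lookup ts l) x ≡ true
    Class⁻ {j} {x} = does⁻ (inClass? j x)

    -- Separator number `i` tells the classes apart: vertices of class `i` dominate it, those of a
    -- later class are dominated by it. It exists because `i < j ≤ k`.
    not-in-two : ∀ {i j x} → toℕ i < toℕ j → Class i x ≡ true → Class j x ≡ true → ⊥
    not-in-two {i} {j} {x} i<j xi xj = asymmetric
      (trans (sym (arc-< (subst (_< toℕ j) (sym l≡i) i<j))) (Class⁻ {j} xj l))
      (trans (sym (arc-≥ (≤-reflexive (sym l≡i)))) (Class⁻ {i} xi l))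
      where
      i<k : toℕ i < k
      i<k = ≤-trans i<j (s≤s⁻¹ (toℕ<n j))
      l : Fin k
      l = fromℕ< i<k
      l≡i : toℕ l ≡ toℕ i
      l≡i = toℕ-fromℕ< i<k

    Class-unique : ∀ {i j x} → Class i x ≡ true → Class j x ≡ true → i ≡ j
    Class-unique {i} {j} xi xj with <-cmp (toℕ i) (toℕ j)
    ... | tri< i<j _ _ = ⊥-elim (not-in-two i<j xi xj)
    ... | tri≈ _ i≡j _ = toℕ-injective i≡j
    ... | tri> _ _ j<i = ⊥-elim (not-in-two j<i xj xi)

    linked : SubsetOf N → (i j : Fin (suc k)) → Fin N → SubsetOf N
    linked alive i j x y = alive y ∧ Class j y ∧ arc (toℕ i) (toℕ j) x y

allIn : SubsetOf N → Vec (Fin N) m → Bool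
allIn A []       = true
allIn A (w ∷ ws) = A w ∧ allIn A ws

allIn-lookup : (A : SubsetOf N) (ws : Vec (Fin N) m) → allIn A ws ≡ true → ∀ j → A (lookup ws j) ≡ true
allIn-lookup A (w ∷ ws) p zero    = ∧ˡ p
allIn-lookup A (w ∷ ws) p (suc j) = allIn-lookup A ws (∧ʳ {A w} p) j

allIn-full : (ws : Vec (Fin N) m) → allIn full ws ≡ true
allIn-full []       = refl
allIn-full (w ∷ ws) = allIn-full ws

allIn-∖ : (A : SubsetOf N) (x : Fin N) (ws : Vec (Fin N) m) → allIn A ws ≡ true →
  allIn (A ∖ x) ws ≡ true ⊎ ∃ λ l → lookup ws l ≡ x
allIn-∖ A x []       p = inj₁ refl
allIn-∖ A x (w ∷ ws) p with x ≟ w | allIn-∖ A x ws (∧ʳ {A w} p)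
... | yes x≡w | _              = inj₂ (zero , sym x≡w)
... | no _    | inj₁ q         = inj₁ (∧-true (∧-true (∧ˡ p) refl) q)
... | no _    | inj₂ (l , eq)  = inj₂ (suc l , eq)

-- Deleting candidates with too few neighbours in another class

module Cleaning {N} (T : Digraph N) (tournament : Tournament T) {q} (ts : Vec (Fin N) (suc q)) (s : ℕ) where
  open Chains T tournament
  open Separators T tournament
  open Classes ts

  selected : SubsetOf N → Vec (Fin N) (suc (suc q)) → Bool
  selected alive ws = chain full (interleave ts ws) ∧ allIn alive ws

  selections : SubsetOf N → ℕ
  selections alive = sumV (suc (suc q)) (χ ∘ selected alive)

  module _ {alive : SubsetOf N} {ws} (sel : selected alive ws ≡ true) where
    open Interleaved (chain⇒Interleaved full ts ws (∧ˡ sel))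

    selected-alive : ∀ j → alive (lookup ws j) ≡ true
    selected-alive = allIn-lookup alive ws (∧ʳ {chain full (interleave ts ws)} sel)

    selected-Class : ∀ j → Class j (lookup ws j) ≡ true
    selected-Class j = dec-true (inClass? j (lookup ws j)) separated
      where
      separated : ∀ l → arc (toℕ l) (toℕ j) (lookup ts l) (lookup ws j) ≡ true
      separated l with toℕ l <? toℕ j
      ... | yes l<j = trans (arc-< l<j) (t→w l j l<j)
      ... | no  l≮j = trans (arc-≥ (≮⇒≥ l≮j)) (w→t j l (≮⇒≥ l≮j))

    selected-arc : ∀ i j → i ≢ j → arc (toℕ i) (toℕ j) (lookup ws i) (lookup ws j) ≡ true
    selected-arc i j i≢j with <-cmp (toℕ i) (toℕ j)
    ... | tri< i<j _ _ = trans (arc-< i<j) (w→w i j i<j)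
    ... | tri≈ _ i≡j _ = contradiction (toℕ-injective i≡j) i≢j
    ... | tri> _ _ j<i = trans (arc-≥ (<⇒≤ j<i)) (w→w j i j<i)

  -- A lost selection has x in position i, and one of the few neighbours of x in position j.
  selections-∖ : ∀ alive x i j → i ≢ j → Class i x ≡ true → card (linked alive i j x) ≤ s →
    selections alive ≤ selections (alive ∖ x) + s * N ^ q
  selections-∖ alive x i j i≢j xi few =
    ≤-trans (sumV-mono (suc (suc q)) _ _ pointwise)
    (≤-trans (≤-reflexive (sumV-+ (suc (suc q)) (χ ∘ selected (alive ∖ x)) lost))
      (+-monoʳ-≤ (selections (alive ∖ x))
        (≤-trans (≤-reflexive (sumV-lookup₂ q (χ ∘ ⁅ x ⁆) (χ ∘ linked alive i j x) i≢j))
          (*-monoˡ-≤ (N ^ q) (≤-trans (≤-reflexive (trans (cong (_* card (linked alive i j x)) (card-singleton x))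
            (*-identityˡ _))) few)))))
    where
    lost : Vec (Fin N) (suc (suc q)) → ℕ
    lost ws = χ (⁅ x ⁆ (lookup ws i)) * χ (linked alive i j x (lookup ws j))
    pointwise : ∀ ws → χ (selected alive ws) ≤ χ (selected (alive ∖ x) ws) + lost ws
    pointwise ws = χ-bound (selected alive ws) λ sel → case allIn-∖ alive x ws (∧ʳ {chain full (interleave ts ws)} sel) of λ
      { (inj₁ still) → ≤-trans (χ-true (∧-true (∧ˡ {chain full (interleave ts ws)} sel) still)) (m≤m+n _ _)
      ; (inj₂ (l , wl≡x)) →
          -- Entry `l` of a selection lies in class `l`, and `x` lies in class `i`. Classes being
          -- disjoint, `x` can occur only at position `i`.
          let i≡l = Class-unique xi (subst (λ y → Class l y ≡ true) wl≡x (selected-Class {alive} sel l))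
              x≡wi = trans (sym wl≡x) (cong (lookup ws) (sym i≡l))
          in ≤-trans (*-mono-≤ (χ-true (dec-true (x ≟ lookup ws i) x≡wi))
               (χ-true (∧-true (selected-alive {alive} sel j) (∧-true (selected-Class {alive} sel j)
                 (subst (λ y → arc (toℕ i) (toℕ j) y (lookup ws j) ≡ true) (sym x≡wi) (selected-arc {alive} sel i j i≢j))))))
               (m≤n+m _ _) }

  record Cleaned : Set where
    field
      alive    : SubsetOf N
      abundant : ∀ {i j x} → i ≢ j → alive x ≡ true → Class i x ≡ true → s ≤ card (linked alive i j x)
      seed     : ∀ j → ∃ λ x → alive x ≡ true × Class j x ≡ true

  -- The strict inequality is the invariant: a deletion lowers its left side by exactly `s * N ^ q`
  -- and its right side by at most that. So `selections` is still positive at the end, and one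
  -- surviving tuple provides all seeds. The number `b` bounds the deletions to come.
  clean : ∀ b alive → card alive ≤ b → s * N ^ q * card alive < selections alive → Cleaned
  clean b alive ≤b enough with any? (λ x → any? (λ i → any? (λ j →
      (alive x ≟ᵇ true) ×-dec (Class i x ≟ᵇ true) ×-dec ¬? (i ≟ j) ×-dec (card (linked alive i j x) <? s))))
  ... | no ¬bad = record
    { alive = alive
    ; abundant = λ {i} {j} {x} i≢j ax xi → ≮⇒≥ λ few → ¬bad (x , i , j , ax , xi , i≢j , few)
    ; seed = λ j → lookup ws j , selected-alive {alive} sel j , selected-Class {alive} sel j }
    where
    found : ∃ λ ws → 0 < χ (selected alive ws)
    found = sumV-pigeonhole (suc (suc q)) 0 (χ ∘ selected alive)
      (≤-<-trans (≤-trans (≤-reflexive (*-zeroʳ (N ^ suc (suc q)))) z≤n) enough)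
    ws = proj₁ found
    sel : selected alive ws ≡ true
    sel = χ-positive _ (proj₂ found)
  clean zero    alive ≤b enough | yes (x , i , j , ax , _) =
    contradiction (≤-trans (≤-reflexive (card-∖ alive ax)) ≤b) λ ()
  clean (suc b) alive ≤b enough | yes (x , i , j , ax , xi , i≢j , few) =
    clean b (alive ∖ x) (s≤s⁻¹ (≤-trans (≤-reflexive (card-∖ alive ax)) ≤b))
      (+-cancelʳ-< (s * N ^ q) _ _ (≤-trans (s≤s (≤-reflexive budget))
        (≤-trans enough (selections-∖ alive x i j i≢j xi (<⇒≤ few)))))
    where
    budget : s * N ^ q * card (alive ∖ x) + s * N ^ q ≡ s * N ^ q * card alive
    budget = trans (+-comm _ (s * N ^ q))
      (trans (sym (*-suc (s * N ^ q) (card (alive ∖ x)))) (cong (s * N ^ q *_) (card-∖ alive ax)))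

^-odd : ∀ N k → N ^ odd k ≡ N * (N ^ k * N ^ k)
^-odd N zero    = refl
^-odd N (suc k) = trans (cong (λ p → N * (N * p)) (^-odd N k)) (lemma N (N ^ k))
  where
  lemma : ∀ a b → a * (a * (a * (b * b))) ≡ a * (a * b * (a * b))
  lemma = solve-∀

odd≡ : ∀ k → suc (odd k) ≡ 2 * k + 2
odd≡ zero    = refl
odd≡ (suc k) = trans (cong (λ c → suc (suc c)) (odd≡ k)) (lemma k)
  where
  lemma : ∀ k → suc (suc (2 * k + 2)) ≡ 2 * suc k + 2
  lemma = solve-∀

record Frame {N} (T : Digraph N) (tournament : Tournament T) (q s : ℕ) : Set where
  field
    ts         : Vec (Fin N) (suc q)
    transitive : ∀ l l′ → toℕ l < toℕ l′ → T (lookup ts l) (lookup ts l′) ≡ true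
    cleaned    : Cleaning.Cleaned T tournament ts s

-- More than `s * N ^ (2 * k)` chains are shared among `N ^ k` choices of separators, so some choice
-- carries more than `s * N ^ k` of them. As `k` is `suc q`, this is `s * N ^ q` for each of the `N`
-- vertices, the initial invariant of `clean`.
frame : ∀ q s → 0 < s → N ≡ 3 ^ (suc (odd (suc q)) C 2) * s → (T : Digraph N) (t : Tournament T) → Frame T t q s
frame {N} q s 0<s N≡ T tournament = record
  { ts = ts
  ; transitive = Interleaved.t→t (chain⇒Interleaved full ts (proj₁ some) (∧ˡ (χ-positive _ (proj₂ some))))
  ; cleaned = clean N full (card≤ full) (≤-<-trans (≤-reflexive budget) (proj₂ separators)) }
  where
  open Chains T tournament
  open Separators T tournament
  count : Vec (Fin N) (suc q) → ℕ
  count ts = Cleaning.selections T tournament ts s full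
  power : N ^ suc q * (s * N ^ suc q) ≡ s * N ^ suc (odd q)
  power = trans (lemma N (N ^ q) s) (cong (λ p → s * (N * p)) (sym (^-odd N q)))
    where
    lemma : ∀ a b s → a * b * (s * (a * b)) ≡ s * (a * (a * (b * b)))
    lemma = solve-∀
  total : chains (odd (suc q)) full ≡ sumV (suc q) count
  total = trans (sumV-interleave (suc q) (χ ∘ chain full)) (sumV-cong (suc q) λ ts → sumV-cong (suc (suc q)) λ ws →
    cong χ (sym (trans (cong (chain full (interleave ts ws) ∧_) (allIn-full ws)) (∧-identityʳ _))))
  separators : ∃ λ ts → s * N ^ suc q < count ts
  separators = sumV-pigeonhole (suc q) (s * N ^ suc q) count
    (≤-<-trans (≤-reflexive power) (≤-trans (many-full-chains (suc (odd q)) s 0<s N≡) (≤-reflexive total)))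
  ts = proj₁ separators
  open Cleaning T tournament ts s
  some : ∃ λ ws → 0 < χ (selected full ws)
  some = sumV-pigeonhole (suc (suc q)) 0 _ (≤-<-trans (≤-trans (≤-reflexive (*-zeroʳ (N ^ suc (suc q)))) z≤n) (proj₂ separators))
  budget : s * N ^ q * card (full {N}) ≡ s * N ^ suc q
  budget = trans (cong (s * N ^ q *_) card-full) (trans (*-assoc s (N ^ q) N) (cong (s *_) (*-comm (N ^ q) N)))

-- Sparseness of trees

module Sparse {n} (F : Digraph n) where

  Adj : Fin n → Fin n → Set
  Adj u v = F u v ≡ true ⊎ F v u ≡ true

  Adj? : ∀ u v → Dec (Adj u v)
  Adj? u v = (F u v ≟ᵇ true) ⊎-dec (F v u ≟ᵇ true)

  Adj-sym : ∀ {u v} → Adj u v → Adj v u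
  Adj-sym (inj₁ p) = inj₂ p
  Adj-sym (inj₂ p) = inj₁ p

  edges : SubsetOf n → ℕ
  edges Z = sum (λ u → sum (λ v → χ (Z u ∧ Z v ∧ F u v)))

  crosses : SubsetOf n → SubsetOf n → Fin n → Fin n → Bool
  crosses P Q u v = ((P u ∧ Q v) ∨ (Q u ∧ P v)) ∧ F u v

  crossings : SubsetOf n → SubsetOf n → ℕ
  crossings P Q = sum (λ u → sum (χ ∘ crosses P Q u))

  edges-full : edges full ≡ arcCount F
  edges-full = sym (trans (sumFin≡sum n _) (sum-cong λ u → sumFin≡sum n _))

  edges-∪ : ∀ P Q → Disjoint P Q → edges P + edges Q + crossings P Q ≤ edges (P ∪ Q)
  edges-∪ P Q disjoint =
    ≤-trans (+-monoˡ-≤ (crossings P Q) (≤-reflexive (sym (trans (sum-cong λ u → sum-+ _ _) (sum-+ _ _)))))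
      (sum-join _ _ _ λ u → sum-join _ _ _ λ v → pointwise (P u) (P v) (F u v) (disjoint u) (disjoint v))
    where
    pointwise : ∀ p p′ f {c c′} → (p ≡ true → c ≡ false) → (p′ ≡ true → c′ ≡ false) →
      χ (p ∧ p′ ∧ f) + χ (c ∧ c′ ∧ f) + χ (((p ∧ c′) ∨ (c ∧ p′)) ∧ f) ≤ χ ((p ∨ c) ∧ (p′ ∨ c′) ∧ f)
    pointwise true  true  false d d′ rewrite d refl | d′ refl = z≤n
    pointwise true  true  true  d d′ rewrite d refl | d′ refl = ≤-refl
    pointwise true  false false {c′ = false} d d′ rewrite d refl = z≤n
    pointwise true  false false {c′ = true}  d d′ rewrite d refl = z≤n
    pointwise true  false true  {c′ = false} d d′ rewrite d refl = z≤n
    pointwise true  false true  {c′ = true}  d d′ rewrite d refl = ≤-refl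
    pointwise false true  false {false} d d′ = z≤n
    pointwise false true  false {true}  d d′ rewrite d′ refl = z≤n
    pointwise false true  true  {false} d d′ = z≤n
    pointwise false true  true  {true}  d d′ rewrite d′ refl = ≤-refl
    pointwise false false f {false} d d′ = z≤n
    pointwise false false f {true} {false} d d′ = z≤n
    pointwise false false false {true} {true} d d′ = z≤n
    pointwise false false true  {true} {true} d d′ = ≤-refl

  crosses-fwd : ∀ P Q {u v} → P u ≡ true → Q v ≡ true → F u v ≡ true → crosses P Q u v ≡ true
  crosses-fwd P Q Pu Qv uv rewrite Pu | Qv = uv

  crosses-bwd : ∀ P Q {u v} → P u ≡ true → Q v ≡ true → F v u ≡ true → crosses P Q v u ≡ true
  crosses-bwd P Q {u} {v} Pu Qv vu rewrite Pu | Qv with P v ∧ Q u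
  ... | false = vu
  ... | true  = vu

  crosses⇒row : ∀ P Q {u v} → crosses P Q u v ≡ true → 1 ≤ sum (χ ∘ crosses P Q u)
  crosses⇒row P Q {u} {v} p = ≤-trans (χ-true p) (sum-term (χ ∘ crosses P Q u) v)

  crossings-positive : ∀ P Q {u v} → P u ≡ true → Q v ≡ true → Adj u v → 1 ≤ crossings P Q
  crossings-positive P Q Pu Qv (inj₁ uv) = ≤-trans (crosses⇒row P Q (crosses-fwd P Q Pu Qv uv)) (sum-term _ _)
  crossings-positive P Q Pu Qv (inj₂ vu) = ≤-trans (crosses⇒row P Q (crosses-bwd P Q Pu Qv vu)) (sum-term _ _)

  crosses-unique : ∀ P Q → crossings P Q ≤ 1 → ∀ {u v u′ v′} →
    crosses P Q u v ≡ true → crosses P Q u′ v′ ≡ true → u ≡ u′ × v ≡ v′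
  crosses-unique P Q ≤1 {u} p p′ with sum≤1⇒unique _ ≤1 (crosses⇒row P Q p) (crosses⇒row P Q p′)
  ... | refl = refl , sum≤1⇒unique _ (≤-trans (sum-term (λ u → sum (χ ∘ crosses P Q u)) u) ≤1) (χ-true p) (χ-true p′)

  -- For a nonempty set of vertices of a tree, having at least `card Z - 1` arcs amounts to being
  -- connected. This counting form replaces walks inside `Z`.
  Dense : SubsetOf n → Set
  Dense Z = card Z ≤ suc (edges Z)

  Dense-singleton : ∀ x → Dense ⁅ x ⁆
  Dense-singleton x = ≤-trans (≤-reflexive (card-singleton x)) (s≤s z≤n)

  Dense-∪ : ∀ P Q {u v} → Disjoint P Q → P u ≡ true → Q v ≡ true → Adj u v → Dense P → Dense Q → Dense (P ∪ Q)
  Dense-∪ P Q disjoint Pu Qv uv denseP denseQ = begin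
    card (P ∪ Q)                             ≡⟨ card-∪ P Q disjoint ⟩
    card P + card Q                          ≤⟨ +-mono-≤ denseP denseQ ⟩
    suc (edges P) + suc (edges Q)            ≡⟨ lemma (edges P) (edges Q) ⟩
    suc (edges P + edges Q + 1)              ≤⟨ s≤s (+-monoʳ-≤ (edges P + edges Q) (crossings-positive P Q Pu Qv uv)) ⟩
    suc (edges P + edges Q + crossings P Q)  ≤⟨ s≤s (edges-∪ P Q disjoint) ⟩
    suc (edges (P ∪ Q))                      ∎
    where
    open ≤-Reasoning
    lemma : ∀ a b → suc a + suc b ≡ suc (a + b + 1)
    lemma = solve-∀

  disjoint-singleton : ∀ (Z : SubsetOf n) y → Z y ≡ false → Disjoint Z ⁅ y ⁆
  disjoint-singleton Z y ¬Zy x Zx = dec-false (y ≟ x) λ { refl → true≢false Zx ¬Zy }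

  card-∪-singleton : ∀ (Z : SubsetOf n) {y} → Z y ≡ false → card (Z ∪ ⁅ y ⁆) ≡ suc (card Z)
  card-∪-singleton Z {y} ¬Zy = trans (card-∪ Z ⁅ y ⁆ (disjoint-singleton Z y ¬Zy))
    (trans (cong (card Z +_) (card-singleton y)) (+-comm (card Z) 1))

  module _ (connected : ∀ u v → UWalk F u v) where

    escape : ∀ (Z : SubsetOf n) {u v} → UWalk F u v → Z u ≡ true → Z v ≡ false →
      ∃₂ λ a b → Z a ≡ true × Z b ≡ false × Adj a b
    escape Z here Zu ¬Zv = true≢false Zu ¬Zv
    escape Z (fwd {v = w} uw walk) Zu ¬Zv with Z w in eq
    ... | true  = escape Z walk eq ¬Zv
    ... | false = _ , w , Zu , eq , inj₁ uw
    escape Z (bwd {v = w} wu walk) Zu ¬Zv with Z w in eq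
    ... | true  = escape Z walk eq ¬Zv
    ... | false = _ , w , Zu , eq , inj₂ wu

    escape-from : ∀ (Z : SubsetOf n) {u v} → Z u ≡ true → Z v ≡ false → ∃₂ λ a b → Z a ≡ true × Z b ≡ false × Adj a b
    escape-from Z {u} {v} = escape Z (connected u v)

    module _ (arcs : arcCount F ≡ n ∸ 1) where

      -- Adding the remaining vertices one at a time, each along an edge, ends with the n - 1 edges of F.
      sparse : ∀ b Z {z} → Z z ≡ true → n ≤ b + card Z → edges Z < card Z
      sparse b Z {z} Zz fuel with any? (λ y → Z y ≟ᵇ false)
      ... | no all = begin-strict
        edges Z     ≤⟨ sum-mono _ _ (λ u → sum-mono _ _ λ v → χ-mono (λ p → ∧ʳ {Z v} (∧ʳ {Z u} p))) ⟩
        edges full  ≡⟨ trans edges-full arcs ⟩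
        n ∸ 1       <⟨ pred< z ⟩
        n           ≡⟨ card-full ⟨
        card full   ≤⟨ card-mono full Z (λ y _ → ¬false (λ eq → all (y , eq))) ⟩
        card Z      ∎
        where
        open ≤-Reasoning
        pred< : ∀ {n} → Fin n → n ∸ 1 < n
        pred< {suc n} _ = ≤-refl
      sparse zero    Z Zz fuel | yes (y , ¬Zy) = contradiction fuel (<⇒≱ (card-<n Z ¬Zy))
      sparse (suc b) Z Zz fuel | yes (y , ¬Zy) with a , c , Za , ¬Zc , ac ← escape-from Z Zz ¬Zy = s≤s⁻¹ (begin-strict
        suc (edges Z)                                ≡⟨ +-comm 1 (edges Z) ⟩
        edges Z + 1                                  ≤⟨ +-mono-≤ (m≤m+n (edges Z) (edges ⁅ c ⁆))
                                                                  (crossings-positive Z ⁅ c ⁆ Za (singleton-refl c) ac) ⟩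
        edges Z + edges ⁅ c ⁆ + crossings Z ⁅ c ⁆    ≤⟨ edges-∪ Z ⁅ c ⁆ (disjoint-singleton Z c ¬Zc) ⟩
        edges (Z ∪ ⁅ c ⁆)                            <⟨ sparse b (Z ∪ ⁅ c ⁆) (cong (_∨ does (c ≟ a)) Za) fuel′ ⟩
        card (Z ∪ ⁅ c ⁆)                             ≡⟨ card-∪-singleton Z ¬Zc ⟩
        suc (card Z)                                 ∎)
        where
        open ≤-Reasoning
        fuel′ : n ≤ b + card (Z ∪ ⁅ c ⁆)
        fuel′ = ≤-trans fuel (≤-reflexive
          (trans (sym (+-suc b (card Z))) (cong (b +_) (sym (card-∪-singleton Z ¬Zc)))))

      -- By `sparse`, `P ∪ Q` has at most `card P + card Q - 1` arcs, and by density all but at most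
      -- one of these lie inside `P` or `Q`. A second crossing would close a cycle.
      one-crossing : ∀ P Q {u} → P u ≡ true → Disjoint P Q → Dense P → Dense Q → crossings P Q ≤ 1
      one-crossing P Q {u} Pu disjoint denseP denseQ = +-cancelˡ-≤ (suc (edges P + edges Q)) _ _ (begin
        suc (edges P + edges Q) + crossings P Q  ≤⟨ s≤s (edges-∪ P Q disjoint) ⟩
        suc (edges (P ∪ Q))                      ≤⟨ sparse n (P ∪ Q) (cong (_∨ Q u) Pu) (m≤m+n n _) ⟩
        card (P ∪ Q)                             ≡⟨ card-∪ P Q disjoint ⟩
        card P + card Q                          ≤⟨ +-mono-≤ denseP denseQ ⟩
        suc (edges P) + suc (edges Q)            ≡⟨ lemma (edges P) (edges Q) ⟩
        suc (edges P + edges Q) + 1              ∎)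
        where
        open ≤-Reasoning
        lemma : ∀ a b → suc a + suc b ≡ suc (a + b) + 1
        lemma = solve-∀

-- Embedding a tree class component by class component

record EmbedsOn {n N} (F : Digraph n) (T : Digraph N) (Q : SubsetOf n) (f : Fin n → Fin N) : Set where
  field
    injective  : ∀ {u v} → Q u ≡ true → Q v ≡ true → f u ≡ f v → u ≡ v
    preserving : ∀ {u v} → Q u ≡ true → Q v ≡ true → F u v ≡ true → T (f u) (f v) ≡ true

-- An abstract interface to the cleaned classes: `W i` holds the candidates for class `i`, and
-- `link i j x` those candidates for class `j` that are joined to `x` in the direction from the
-- lower class to the higher, which arcs of `F` between classes have by `cl-mono`.
module Embedding {n N c s : ℕ} (F : Digraph n) (connected : ∀ u v → UWalk F u v) (arcs : arcCount F ≡ n ∸ 1)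
  (cl : Fin n → Fin c) (cl-mono : ∀ {u v} → F u v ≡ true → toℕ (cl u) ≤ toℕ (cl v))
  (T : Digraph N) (W : Fin c → SubsetOf N) (link : Fin c → Fin c → Fin N → SubsetOf N)
  (link⊆W : ∀ {i j x y} → link i j x y ≡ true → W j y ≡ true)
  (link-out : ∀ {i j x y} → toℕ i < toℕ j → link i j x y ≡ true → T x y ≡ true)
  (link-in : ∀ {i j x y} → toℕ j < toℕ i → link i j x y ≡ true → T y x ≡ true)
  (abundant : ∀ {i j x} → i ≢ j → W i x ≡ true → s ≤ card (link i j x))
  (seed : ∀ j → ∃ λ x → W j x ≡ true)
  (another : ∀ (i : Fin c) → ∃ λ j → j ≢ i)
  where

  open Sparse F

  module Loop
    -- The allowance `n ∸ card Q` comes from the definition of unv*. The double negation is there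
    -- because unv of a piece is obtained only classically.
    (piece : ∀ Q Y → s ≤ card Y + (n ∸ card Q) →
      ¬ ¬ (∃ λ f → EmbedsOn F T Q f × (∀ {v} → Q v ≡ true → Y (f v) ≡ true))) where

    -- Such a `P` is a union of components of classes, so an edge leaving it always changes class.
    Closed : SubsetOf n → Set
    Closed P = ∀ {u v} → P u ≡ true → cl u ≡ cl v → Adj u v → P v ≡ true

    record Component (P : SubsetOf n) (x : Fin n) : Set where
      field
        Q        : SubsetOf n
        x∈Q      : Q x ≡ true
        class    : ∀ {v} → Q v ≡ true → cl v ≡ cl x
        disjoint : Disjoint P Q
        dense    : Dense Q
        closed   : Closed Q

    -- From `x` on, neighbours in the same class are added one by one until none is left; each
    -- arrives with an edge, which keeps the set dense.
    component : ∀ P x → Closed P → P x ≡ false → Component P x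
    component P x closedP ¬Px =
      grow n ⁅ x ⁆ (singleton-refl x) (λ p → cong cl (sym (singleton⁻ p)))
        (disjoint-singleton P x ¬Px) (Dense-singleton x) (m≤m+n n _)
      where
      grow : ∀ b Q → Q x ≡ true → (∀ {v} → Q v ≡ true → cl v ≡ cl x) → Disjoint P Q → Dense Q → n ≤ b + card Q → Component P x
      grow b Q x∈Q class disjoint dense fuel with any? (λ u → any? (λ v →
          (Q u ≟ᵇ true) ×-dec (Q v ≟ᵇ false) ×-dec (cl u ≟ cl v) ×-dec Adj? u v))
      ... | no ¬p = record { Q = Q ; x∈Q = x∈Q ; class = class ; disjoint = disjoint ; dense = dense
                           ; closed = λ {u} {v} Qu same uv → ¬false λ ¬Qv → ¬p (u , v , Qu , ¬Qv , same , uv) }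
      grow zero    Q x∈Q class disjoint dense fuel | yes (u , v , Qu , ¬Qv , _) = contradiction fuel (<⇒≱ (card-<n Q ¬Qv))
      grow (suc b) Q x∈Q class disjoint dense fuel | yes (u , v , Qu , ¬Qv , same , uv) =
        grow b (Q ∪ ⁅ v ⁆) (cong (_∨ does (v ≟ x)) x∈Q) class′ disjoint′
          (Dense-∪ Q ⁅ v ⁆ (disjoint-singleton Q v ¬Qv) Qu (singleton-refl v) uv dense (Dense-singleton v))
          (≤-trans fuel (≤-reflexive (trans (sym (+-suc b (card Q))) (cong (b +_) (sym (card-∪-singleton Q ¬Qv))))))
        where
        class′ : ∀ {w} → (Q ∪ ⁅ v ⁆) w ≡ true → cl w ≡ cl x
        class′ {w} p with Q w in eq
        ... | true  = class eq
        ... | false = trans (sym (trans same (cong cl (singleton⁻ p)))) (class Qu)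
        -- If `v` were in `P`, then closedness would put its neighbour `u`, of the same class, into
        -- `P` as well.
        disjoint′ : Disjoint P (Q ∪ ⁅ v ⁆)
        disjoint′ y Py rewrite disjoint y Py = dec-false (v ≟ y)
          λ { refl → true≢false Qu (disjoint u (closedP Py (sym same) (Adj-sym uv))) }

    record Partial (P : SubsetOf n) : Set where
      field
        f      : Fin n → Fin N
        embeds : EmbedsOn F T P f
        inW    : ∀ {v} → P v ≡ true → W (cl v) (f v) ≡ true
        closed : Closed P

    empty : SubsetOf n
    empty _ = false

    -- The component is placed in Y minus the image of P, which still has at least s - |P| vertices.
    extend : ∀ {P x} (E : Partial P) (K : Component P x) (Y : SubsetOf N) → s ≤ card Y →
      (∀ {y} → Y y ≡ true → W (cl x) y ≡ true) →
      (∀ {u v y} → P u ≡ true → Component.Q K v ≡ true → Y y ≡ true → F u v ≡ true → T (Partial.f E u) y ≡ true) →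
      (∀ {u v y} → P u ≡ true → Component.Q K v ≡ true → Y y ≡ true → F v u ≡ true → T y (Partial.f E u) ≡ true) →
      ¬ ¬ Partial (P ∪ Component.Q K)
    extend {P} {x} E K Y s≤Y Y⊆W forth back done = piece Q Y′ room λ { (g , embedsg , g∈Y′) → done (Glue.glued g embedsg g∈Y′) }
      where
      module E = Partial E
      module K = Component K
      open E using (f)
      open K using (Q)
      Y′ : SubsetOf N
      Y′ = avoidImage f Y P
      room : s ≤ card Y′ + (n ∸ card Q)
      -- The at most `card P` discarded vertices fit into the allowance: `P` and `Q` are disjoint,
      -- so `card P ≤ n ∸ card Q`.
      room = ≤-trans s≤Y (≤-trans (card-avoidImage f Y P) (+-monoʳ-≤ (card Y′) (m+n≤o⇒m≤o∸n (card P)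
        (≤-trans (≤-reflexive (sym (card-∪ P Q K.disjoint))) (card≤ (P ∪ Q))))))
      closedPQ : Closed (P ∪ Q)
      closedPQ {u} {v} p same uv with P u in Pu
      ... | true  rewrite E.closed Pu same uv = refl
      ... | false rewrite K.closed p same uv = ∨-zeroʳ (P v)
      module Glue (g : Fin n → Fin N) (embedsg : EmbedsOn F T Q g) (g∈Y′ : ∀ {v} → Q v ≡ true → Y′ (g v) ≡ true) where
        module G = EmbedsOn embedsg
        module F = EmbedsOn E.embeds
        g∈Y : ∀ {v} → Q v ≡ true → Y (g v) ≡ true
        g∈Y Qv = ∧ˡ (g∈Y′ Qv)
        fresh : ∀ {u v} → P u ≡ true → Q v ≡ true → f u ≢ g v
        fresh {u} {v} Pu Qv eq = does-false⁻ (inImage? f P (g v)) (not⁻ (∧ʳ {Y (g v)} (g∈Y′ Qv))) (u , Pu , eq)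
        h : Fin n → Fin N
        h v = if P v then f v else g v
        h-injective : ∀ {u v} → (P ∪ Q) u ≡ true → (P ∪ Q) v ≡ true → h u ≡ h v → u ≡ v
        h-injective {u} {v} p p′ eq with P u in Pu | P v in Pv
        ... | true  | true  = F.injective Pu Pv eq
        ... | true  | false = contradiction eq (fresh Pu p′)
        ... | false | true  = contradiction (sym eq) (fresh Pv p)
        ... | false | false = G.injective p p′ eq
        h-preserving : ∀ {u v} → (P ∪ Q) u ≡ true → (P ∪ Q) v ≡ true → F u v ≡ true → T (h u) (h v) ≡ true
        h-preserving {u} {v} p p′ uv with P u in Pu | P v in Pv
        ... | true  | true  = F.preserving Pu Pv uv
        ... | true  | false = forth Pu p′ (g∈Y p′) uv
        ... | false | true  = back Pv p (g∈Y p) uv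
        ... | false | false = G.preserving p p′ uv
        h-inW : ∀ {v} → (P ∪ Q) v ≡ true → W (cl v) (h v) ≡ true
        h-inW {v} p with P v in Pv
        ... | true  = E.inW Pv
        ... | false = subst (λ i → W i (g v) ≡ true) (sym (K.class p)) (Y⊆W (g∈Y p))
        glued : Partial (P ∪ Q)
        glued = record
          { f = h
          ; embeds = record { injective = h-injective ; preserving = h-preserving }
          ; inW = h-inW
          ; closed = closedPQ }

    -- The edge between `p` and `x` is the only one between `P` and the component, so `x` alone has
    -- to be joined correctly to the image of `p`. Keeping the whole component in the neighbourhood
    -- of that image ensures this wherever `x` lands.
    attach : ∀ {P p x} → P p ≡ true → P x ≡ false → Adj p x → Dense P → (E : Partial P) (K : Component P x) →
      ¬ ¬ Partial (P ∪ Component.Q K)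
    attach {P} {p} {x} Pp ¬Px px denseP E K =
      extend E K Y (abundant p≢x (E.inW Pp)) link⊆W forth back
      where
      module E = Partial E
      module K = Component K
      open E using (f)
      open K using (Q)
      p≢x : cl p ≢ cl x
      p≢x same = true≢false (E.closed Pp same px) ¬Px
      Y : SubsetOf N
      Y = link (cl p) (cl x) (f p)
      ≤1 : crossings P Q ≤ 1
      ≤1 = one-crossing connected arcs P Q Pp K.disjoint denseP K.dense
      forth : ∀ {u v y} → P u ≡ true → Q v ≡ true → Y y ≡ true → F u v ≡ true → T (f u) y ≡ true
      forth {u} {v} Pu Qv Yy uv = case px of λ
        { (inj₁ arc) → case crosses-unique P Q ≤1 (crosses-fwd P Q Pu Qv uv) (crosses-fwd P Q Pp K.x∈Q arc) of λ
            { (refl , refl) → link-out (≤∧≢⇒< (cl-mono arc) (p≢x ∘ toℕ-injective)) Yy }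
        -- By uniqueness the arc out of `P` would be the arc from `x` to `p`, which puts `x` into
        -- `P`.
        ; (inj₂ arc) → case crosses-unique P Q ≤1 (crosses-fwd P Q Pu Qv uv) (crosses-bwd P Q Pp K.x∈Q arc) of λ
            { (refl , refl) → true≢false Pu ¬Px } }
      back : ∀ {u v y} → P u ≡ true → Q v ≡ true → Y y ≡ true → F v u ≡ true → T y (f u) ≡ true
      back {u} {v} Pu Qv Yy vu = case px of λ
        { (inj₁ arc) → case crosses-unique P Q ≤1 (crosses-bwd P Q Pu Qv vu) (crosses-fwd P Q Pp K.x∈Q arc) of λ
            { (refl , refl) → true≢false Pu ¬Px }
        ; (inj₂ arc) → case crosses-unique P Q ≤1 (crosses-bwd P Q Pu Qv vu) (crosses-bwd P Q Pp K.x∈Q arc) of λ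
            { (refl , refl) → link-in (≤∧≢⇒< (cl-mono arc) (p≢x ∘ sym ∘ toℕ-injective)) Yy } }

    Result : Set
    Result = ∃ λ f → EmbedsOn F T full f × (∀ v → W (cl v) (f v) ≡ true)

    -- The embedded part stays dense, hence each new component meets it in a single edge. The number
    -- `b` bounds the vertices still missing, and every component contributes at least `x`.
    loop : ∀ b P {p} → P p ≡ true → Dense P → Partial P → n ≤ b + card P → ¬ ¬ Result
    loop b P Pp denseP E fuel done with any? (λ y → P y ≟ᵇ false)
    ... | no all = done (f , record { injective = λ {u} {v} _ _ → injective (inP u) (inP v)
                                    ; preserving = λ {u} {v} _ _ → preserving (inP u) (inP v) } , λ v → inW (inP v))
      where
      open Partial E
      open EmbedsOn embeds
      inP : ∀ y → P y ≡ true
      inP y = ¬false λ ¬Py → all (y , ¬Py)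
    loop zero P Pp denseP E fuel done | yes (y , ¬Py) = contradiction fuel (<⇒≱ (card-<n P ¬Py))
    loop (suc b) P Pp denseP E fuel done | yes (y , ¬Py)
      with p , x , P∋p , ¬Px , px ← escape-from connected P Pp ¬Py = attach P∋p ¬Px px denseP E K λ E′ →
        loop b (P ∪ Q) (cong (_∨ Q p) P∋p) (Dense-∪ P Q disjoint P∋p x∈Q px denseP dense) E′ fuel′ done
      where
      K : Component P x
      K = component P x (Partial.closed E) ¬Px
      open Component K
      fuel′ : n ≤ b + card (P ∪ Q)
      fuel′ = s≤s⁻¹ (≤-trans (s≤s fuel) (≤-trans (s≤s (≤-reflexive (sym (+-suc b (card P)))))
        (s≤s (+-monoʳ-≤ b (card-strict P (P ∪ Q) (λ v Pv → cong (_∨ Q v) Pv) (trans (cong (P x ∨_) x∈Q) (∨-zeroʳ (P x))) ¬Px)))))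

    embedding : Fin n → ¬ ¬ Result
    -- The first component has nothing to be attached to. It goes into the neighbourhood of a seed
    -- `w` of another class, merely because this offers `s` candidates; `w` is also the default
    -- value of the empty map.
    embedding x done = extend E₀ K (link i (cl x) w) (abundant i≢ w∈W) link⊆W (λ ()) (λ ()) λ E →
        loop n (empty ∪ Q) x∈Q dense E (m≤m+n n _) done
      where
      i : Fin c
      i = proj₁ (another (cl x))
      i≢ = proj₂ (another (cl x))
      w = proj₁ (seed i)
      w∈W = proj₂ (seed i)
      E₀ : Partial empty
      E₀ = record { f = λ _ → w ; embeds = record { injective = λ () ; preserving = λ () } ; inW = λ () ; closed = λ () }
      K : Component empty x
      K = component empty x (λ ()) refl
      open Component K

-- Small forests inside large vertex sets

-- Infinite descent, doubly negated since `P` need not be decidable. It yields unv of a digraph that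
-- is unavoidable for some order.
least-number : (P : ℕ → Set) → ∀ {p} → P p → ¬ ¬ (∃ λ q → P q × (∀ r → P r → q ≤ r))
least-number P {p} Pp none = never p (<-wellFounded p) Pp
  where
  never : ∀ q → Acc _<_ q → ¬ P q
  never q (acc below) Pq = none (q , Pq , λ r Pr → ≮⇒≥ λ r<q → never r (below r<q) Pr)

contains-trans : ∀ {a b c} {A : Digraph a} {B : Digraph b} {G : Digraph c} → Contains A B → Contains B G → Contains A G
contains-trans (f , f-inj , f-arc) (g , g-inj , g-arc) =
  f ∘ g , g-inj ∘ f-inj , λ u v uv → f-arc (g u) (g v) (g-arc u v uv)

-- For the subdigraph `H` induced by `Q`, the definition of unv* gives unv(H) + (n - |Q|) ≤ s. So
-- unv(H) ≤ |Y|, and `H` is found inside `Y`. That unv(H) exists follows from the unavoidability of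
-- `F`.
unvStar-piece : ∀ {p} {F : Digraph n} → Unavoidable p F → IsUnvStar F s →
  {T : Digraph N} → Tournament T → Fin N → ∀ Q Y → s ≤ card Y + (n ∸ card Q) →
  ¬ ¬ (∃ λ f → EmbedsOn F T Q f × (∀ {v} → Q v ≡ true → Y (f v) ≡ true))
unvStar-piece {n = n} {s = s} {N = N} {p = p} {F} unavF (bounded , _) {T} (loopless , antisymmetric) default Q Y room done =
  least-number (λ q → Unavoidable q H) unavH (place)
  where
  module Q = Enumeration (enumerate Q)
  module Y = Enumeration (enumerate Y)
  H : Digraph (card Q)
  H i j = F (Q.elem i) (Q.elem j)
  H⊆F : Contains F H
  H⊆F = Q.elem , Q.injective , λ u v uv → uv
  unavH : Unavoidable p H
  unavH T′ t′ = contains-trans {A = T′} {B = F} {G = H} (unavF T′ t′) H⊆F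
  place : ¬ (∃ λ q → IsUnv H q)
  place (q , unavq , least) = done (f , record { injective = f-injective ; preserving = f-preserving } , f∈Y)
    where
    q≤Y : q ≤ card Y
    q≤Y = +-cancelʳ-≤ (n ∸ card Q) q (card Y) (≤-trans (bounded (card Q) H H⊆F q (unavq , least)) room)
    κ : Fin q → Fin N
    κ i = Y.elem (inject≤ i q≤Y)
    κ-injective : Injective _≡_ _≡_ κ
    κ-injective eq = inject≤-injective q≤Y q≤Y _ _ (Y.injective eq)
    T′ : Digraph q
    T′ i j = T (κ i) (κ j)
    copy : Contains T′ H
    copy = unavq T′ ((λ i → loopless (κ i)) , λ i j i≢j → antisymmetric (κ i) (κ j) (i≢j ∘ κ-injective))
    g = proj₁ copy
    f : Fin n → Fin N
    f v with Q v ≟ᵇ true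
    ... | yes Qv = κ (g (proj₁ (Q.complete v Qv)))
    ... | no _   = default
    f-value : ∀ {v} → Q v ≡ true → ∃ λ i → Q.elem i ≡ v × f v ≡ κ (g i)
    f-value {v} Qv with Q v ≟ᵇ true
    ... | yes Qv′ = proj₁ (Q.complete v Qv′) , proj₂ (Q.complete v Qv′) , refl
    ... | no ¬Qv  = contradiction Qv ¬Qv
    f∈Y : ∀ {v} → Q v ≡ true → Y (f v) ≡ true
    f∈Y Qv with i , _ , eq ← f-value Qv = trans (cong Y eq) (Y.member (inject≤ (g i) q≤Y))
    f-injective : ∀ {u v} → Q u ≡ true → Q v ≡ true → f u ≡ f v → u ≡ v
    f-injective Qu Qv eq with i , refl , fu ← f-value Qu | j , refl , fv ← f-value Qv =
      cong Q.elem (proj₁ (proj₂ copy) (κ-injective (trans (sym fu) (trans eq fv))))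
    f-preserving : ∀ {u v} → Q u ≡ true → Q v ≡ true → F u v ≡ true → T (f u) (f v) ≡ true
    f-preserving Qu Qv uv with i , refl , fu ← f-value Qu | j , refl , fv ← f-value Qv =
      trans (cong₂ T fu fv) (proj₂ (proj₂ copy) i j uv)

-- Containment is decidable

searchVec : ∀ m {P : Vec (Fin N) m → Set} → (∀ v → Dec (P v)) → Dec (∃ P)
searchVec zero    P? = map′ (λ p → [] , p) (λ { ([] , p) → p }) (P? [])
searchVec (suc m) P? = map′ (λ { (x , v , p) → x ∷ v , p }) (λ { (x ∷ v , p) → x , v , p })
  (any? (λ x → searchVec m (λ v → P? (x ∷ v))))

-- Maps are searched as vectors, of which there are finitely many. This decision finally removes the
-- double negations.
contains? : (T : Digraph N) (D : Digraph m) → Dec (Contains T D)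
contains? {N} {m} T D = map′ (λ { (v , inj , arc) → lookup v , (λ {i} {j} → inj i j) , arc })
  (λ { (f , inj , arc) → tabulate f
     , (λ i j eq → inj (trans (sym (lookup∘tabulate f i)) (trans eq (lookup∘tabulate f j))))
     , λ i j ij → trans (cong₂ T (lookup∘tabulate f i) (lookup∘tabulate f j)) (arc i j ij) })
  (searchVec m λ v → all? (λ i → all? λ j → (lookup v i ≟ lookup v j) →-dec (i ≟ j))
    ×-dec all? (λ i → all? λ j → (D i j ≟ᵇ true) →-dec (T (lookup v i) (lookup v j) ≟ᵇ true)))

-- Linear extensions of acyclic digraphs

-- Double negation passes through a finite quantifier; below this allows reachability to be taken as
-- decided for all pairs at once.
¬¬-finite : ∀ {m} {P : Fin m → Set} → (∀ i → ¬ ¬ P i) → ¬ ¬ (∀ i → P i)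
¬¬-finite {zero}  _ done = done λ ()
¬¬-finite {suc m} h done = h zero λ p₀ → ¬¬-finite (h ∘ suc) λ ps → done λ { zero → p₀ ; (suc i) → ps i }

record LinearOrder {M} (D : Digraph M) : Set where
  field
    π           : Fin M → ℕ
    π-injective : ∀ {x y} → π x ≡ π y → x ≡ y
    π-mono      : ∀ {x y} → D x y ≡ true → π x < π y

-- Order the vertices by their number of ancestors, breaking ties by the index.
linear-order : ∀ {M} (D : Digraph M) → Acyclic D → ¬ ¬ LinearOrder D
linear-order {M} D acyclic done =
  ¬¬-finite (λ x → ¬¬-finite (λ y → ¬¬-excluded-middle {A = Reach D x y})) (done ∘ order)
  where
  snoc : ∀ {x y z} → Reach D x y → D y z ≡ true → Reach D x z
  snoc (step xy)  yz = xy ∷ step yz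
  snoc (xw ∷ wy)  yz = xw ∷ snoc wy yz
  order : (∀ x y → Dec (Reach D x y)) → LinearOrder D
  order reach? = record { π = π ; π-injective = π-injective ; π-mono = λ xy → π-< (ancestors-< xy) }
    where
    ancestors : Fin M → ℕ
    ancestors x = card (λ y → does (reach? y x))
    -- Ancestors of `x` are ancestors of `y`; so is `x`, which by acyclicity is not its own
    -- ancestor.
    ancestors-< : ∀ {x y} → D x y ≡ true → ancestors x < ancestors y
    ancestors-< {x} {y} xy = card-strict _ _
      (λ z p → dec-true (reach? z y) (snoc (does⁻ (reach? z x) p) xy))
      (dec-true (reach? x y) (step xy)) (dec-false (reach? x x) (acyclic x))
    -- Indices are below `M`, so the factor `M` lets the number of ancestors decide first.
    π : Fin M → ℕ
    π x = M * ancestors x + toℕ x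
    π-< : ∀ {x y} → ancestors x < ancestors y → π x < π y
    π-< {x} {y} lt = begin-strict
      M * ancestors x + toℕ x  <⟨ +-monoʳ-< (M * ancestors x) (toℕ<n x) ⟩
      M * ancestors x + M      ≡⟨ trans (+-comm _ M) (sym (*-suc M (ancestors x))) ⟩
      M * suc (ancestors x)    ≤⟨ *-monoʳ-≤ M lt ⟩
      M * ancestors y          ≤⟨ m≤m+n _ (toℕ y) ⟩
      π y                      ∎
      where open ≤-Reasoning
    π-injective : ∀ {x y} → π x ≡ π y → x ≡ y
    π-injective {x} {y} eq with <-cmp (ancestors x) (ancestors y)
    ... | tri< lt _ _ = contradiction eq (<⇒≢ (π-< lt))
    ... | tri> _ _ gt = contradiction (sym eq) (<⇒≢ (π-< gt))
    ... | tri≈ _ same _ = toℕ-injective (+-cancelˡ-≡ (M * ancestors y) _ _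
            (trans (cong (λ a → M * a + toℕ x) (sym same)) eq))

-- The added vertices cut a linear extension of D into k + 1 classes of old vertices.
module Cuts {n k} {D : Digraph (n + k)} (order : LinearOrder D)
  (e : Fin n → Fin (n + k)) (e-injective : Injective _≡_ _≡_ e) where
  open LinearOrder order

  old? : ∀ x → Dec (∃ λ v → e v ≡ x)
  old? x = any? (λ v → e v ≟ x)

  added : SubsetOf (n + k)
  added x = not (does (old? x))

  card-added : card added ≤ k
  card-added = +-cancelˡ-≤ n _ _ (≤-trans (+-monoˡ-≤ _ (card-image e e-injective))
    (≤-trans (sum-join _ _ _ λ x → complementary (does (old? x))) (≤-reflexive card-full)))
    where
    complementary : ∀ b → χ b + χ (not b) ≤ χ true
    complementary false = ≤-refl
    complementary true  = ≤-refl

  before : Fin (n + k) → SubsetOf (n + k)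
  before x y = added y ∧ does (π y <? π x)

  -- For an old vertex this will be its class, for an added one the index of its separator.
  rank : Fin (n + k) → ℕ
  rank x = card (before x)

  before-π : ∀ {x y} → before x y ≡ true → π y < π x
  before-π {x} {y} p = does⁻ (π y <? π x) (∧ʳ {added y} p)

  before-irrefl : ∀ x → before x x ≡ false
  before-irrefl x with before x x in eq
  ... | false = refl
  ... | true  = contradiction (before-π {x} eq) (<-irrefl refl)

  before-mono : ∀ {x y} → π x ≤ π y → ∀ z → before x z ≡ true → before y z ≡ true
  before-mono {x} {y} le z p = ∧-true (∧ˡ p) (dec-true (π z <? π y) (≤-trans (before-π {x} p) le))

  rank-mono : ∀ {x y} → π x ≤ π y → rank x ≤ rank y
  rank-mono {x} {y} le = card-mono _ _ (before-mono {x} {y} le)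

  rank-strict : ∀ {x y} → added x ≡ true → π x < π y → rank x < rank y
  rank-strict {x} {y} ax lt = card-strict _ _ (before-mono {x} {y} (<⇒≤ lt))
    (∧-true ax (dec-true (π x <? π y) lt)) (before-irrefl x)

  rank≤k : ∀ x → rank x ≤ k
  rank≤k x = ≤-trans (card-mono (before x) added (λ _ → ∧ˡ)) card-added

  -- Strict because `x` is itself added but not before itself; so its rank is a valid index among
  -- the `k` separators.
  rank<k : ∀ {x} → added x ≡ true → rank x < k
  rank<k {x} ax = ≤-trans (card-strict (before x) added (λ _ → ∧ˡ) ax (before-irrefl x)) card-added

  cl : Fin n → Fin (suc k)
  cl v = fromℕ< (s≤s (rank≤k (e v)))

  toℕ-cl : ∀ v → toℕ (cl v) ≡ rank (e v)
  toℕ-cl v = toℕ-fromℕ< (s≤s (rank≤k (e v)))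

  cl-mono : ∀ {u v} → D (e u) (e v) ≡ true → toℕ (cl u) ≤ toℕ (cl v)
  cl-mono {u} {v} uv = subst₂ _≤_ (sym (toℕ-cl u)) (sym (toℕ-cl v)) (rank-mono (<⇒≤ (π-mono uv)))

-- Assembling the copy of `D` from the tree and the separators

module Assembly {n q N s} {F : Digraph n} {D : Digraph (n + suc q)} (order : LinearOrder D)
  (e : Fin n → Fin (n + suc q)) (e-injective : Injective _≡_ _≡_ e) (e-arcs : ∀ u v → D (e u) (e v) ≡ F u v)
  {T : Digraph N} (tournament : Tournament T) (fr : Frame T tournament q s) where

  open LinearOrder order
  open Cuts order e e-injective
  open Chains T tournament
  open Separators T tournament
  open Frame fr
  open Classes ts
  open Cleaning.Cleaned cleaned

  W : Fin (suc (suc q)) → SubsetOf N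
  W j y = alive y ∧ Class j y

  link : Fin (suc (suc q)) → Fin (suc (suc q)) → Fin N → SubsetOf N
  link = linked alive

  link⊆W : ∀ {i j x y} → link i j x y ≡ true → W j y ≡ true
  link⊆W {i} {j} {x} {y} p = ∧-true {alive y} (∧ˡ p) (∧ˡ {Class j y} (∧ʳ {alive y} p))

  link-arc : ∀ {i j x y} → link i j x y ≡ true → arc (toℕ i) (toℕ j) x y ≡ true
  link-arc {i} {j} {x} {y} p = ∧ʳ {Class j y} (∧ʳ {alive y} p)

  link-out : ∀ {i j x y} → toℕ i < toℕ j → link i j x y ≡ true → T x y ≡ true
  link-out {i} {j} {x} {y} i<j p = trans (sym (arc-< i<j)) (link-arc {i} {j} {x} {y} p)

  link-in : ∀ {i j x y} → toℕ j < toℕ i → link i j x y ≡ true → T y x ≡ true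
  link-in {i} {j} {x} {y} j<i p = trans (sym (arc-≥ (<⇒≤ j<i))) (link-arc {i} {j} {x} {y} p)

  linked-abundant : ∀ {i j x} → i ≢ j → W i x ≡ true → s ≤ card (link i j x)
  linked-abundant {x = x} i≢j p = abundant i≢j (∧ˡ p) (∧ʳ {alive x} p)

  seedW : ∀ j → ∃ λ x → W j x ≡ true
  seedW j with x , ax , xj ← seed j = x , ∧-true ax xj

  F-mono : ∀ {u v} → F u v ≡ true → toℕ (cl u) ≤ toℕ (cl v)
  F-mono {u} {v} uv = cl-mono (trans (e-arcs u v) uv)

  another : ∀ (i : Fin (suc (suc q))) → ∃ λ j → j ≢ i
  another zero    = suc zero , λ ()
  another (suc i) = zero , λ ()

  module Glue (f : Fin n → Fin N) (embeds : EmbedsOn F T full f) (f∈W : ∀ v → W (cl v) (f v) ≡ true) where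
    open EmbedsOn embeds

    separator : ∀ {x} → added x ≡ true → Fin (suc q)
    separator ax = fromℕ< (rank<k ax)

    toℕ-separator : ∀ {x} (ax : added x ≡ true) → toℕ (separator ax) ≡ rank x
    toℕ-separator ax = toℕ-fromℕ< (rank<k ax)

    place : ∀ x → Dec (∃ λ v → e v ≡ x) → Fin N
    isAdded : ∀ {x} → ¬ (∃ λ v → e v ≡ x) → added x ≡ true
    isAdded {x} ¬old = cong not (dec-false (old? x) ¬old)
    place x (yes (v , _)) = f v
    place x (no ¬old)     = lookup ts (separator (isAdded ¬old))

    separated : ∀ {x} (ax : added x ≡ true) v →
      arc (toℕ (separator ax)) (toℕ (cl v)) (lookup ts (separator ax)) (f v) ≡ true
    separated ax v = Class⁻ {cl v} (∧ʳ {alive (f v)} (f∈W v)) (separator ax)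

    separator-arc : ∀ {x y} (ax : added x ≡ true) (ay : added y ≡ true) → π x < π y →
      T (lookup ts (separator ax)) (lookup ts (separator ay)) ≡ true
    separator-arc ax ay lt = transitive _ _
      (subst₂ _<_ (sym (toℕ-separator ax)) (sym (toℕ-separator ay)) (rank-strict ax lt))

    -- An old vertex before an added one has at most the same rank, while an added vertex before an
    -- old one has strictly smaller rank. This is exactly where `arc` switches direction.
    place-arc : ∀ {x y} x? y? → D x y ≡ true → T (place x x?) (place y y?) ≡ true
    place-arc (yes (u , refl)) (yes (v , refl)) xy = preserving refl refl (trans (sym (e-arcs u v)) xy)
    place-arc (yes (u , refl)) (no ¬y) xy = trans
      (sym (arc-≥ (subst₂ _≤_ (sym (toℕ-cl u)) (sym (toℕ-separator (isAdded ¬y))) (rank-mono (<⇒≤ (π-mono xy))))))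
      (separated (isAdded ¬y) u)
    place-arc (no ¬x) (yes (v , refl)) xy = trans
      (sym (arc-< (subst₂ _<_ (sym (toℕ-separator (isAdded ¬x))) (sym (toℕ-cl v)) (rank-strict (isAdded ¬x) (π-mono xy)))))
      (separated (isAdded ¬x) v)
    place-arc (no ¬x) (no ¬y) xy = separator-arc (isAdded ¬x) (isAdded ¬y) (π-mono xy)

    place-injective : ∀ {x y} x? y? → place x x? ≡ place y y? → x ≡ y
    place-injective (yes (u , refl)) (yes (v , refl)) eq = cong e (injective refl refl eq)
    place-injective (yes (u , refl)) (no ¬y) eq = contradiction (sym eq) (arc⇒≢ _ (toℕ (cl u)) (separated (isAdded ¬y) u))
    place-injective (no ¬x) (yes (v , refl)) eq = contradiction eq (arc⇒≢ _ (toℕ (cl v)) (separated (isAdded ¬x) v))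
    place-injective {x} {y} (no ¬x) (no ¬y) eq with <-cmp (π x) (π y)
    ... | tri≈ _ same _ = π-injective same
    ... | tri< lt _ _ = true≢false (separator-arc (isAdded ¬x) (isAdded ¬y) lt)
                          (trans (cong (T _) (sym eq)) (loopless _))
    ... | tri> _ _ gt = true≢false (separator-arc (isAdded ¬y) (isAdded ¬x) gt)
                          (trans (cong (T _) eq) (loopless _))

    contains : Contains T D
    contains = (λ x → place x (old? x)) , (λ {x} {y} → place-injective (old? x) (old? y))
             , λ x y → place-arc (old? x) (old? y)

  contained : (∀ u v → UWalk F u v) → arcCount F ≡ n ∸ 1 → ∀ {p} → Unavoidable p F → IsUnvStar F s →
    Fin n → ¬ ¬ Contains T D
  contained connected arcs {p} unavF unvStar x done =
    embedding (unvStar-piece {p = p} {F} unavF unvStar tournament (proj₁ (seed zero))) x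
      λ { (f , embeds , f∈W) → done (Glue.contains f embeds f∈W) }
    where
    open Embedding.Loop F connected arcs cl F-mono T W link
      (λ {i} {j} {x} {y} → link⊆W {i} {j} {x} {y}) link-out link-in linked-abundant seedW another

-- The empty subdigraph has unv 0 and leaves all `n` vertices over. This makes `s` positive.
unvStar≥order : (F : Digraph n) → IsUnvStar F s → n ≤ s
unvStar≥order F (bounded , _) = bounded 0 (λ ()) ((λ ()) , (λ { {()} }) , λ ()) 0
  ((λ _ _ → (λ ()) , (λ { {()} }) , λ ()) , λ _ _ → z≤n)

theorem24 : (k n : ℕ) → 1 ≤ k → 2 ≤ n → (F : Digraph n) → OrientedTree F
    → (D : Digraph (n + k)) → IsExtension k F D
    → (u s : ℕ) → IsUnv D u → IsUnvStar F s
    → u ≤ 3 ^ ((2 * k + 2) C 2) * s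
theorem24 (suc q) n@(suc _) 1≤k 2≤n F (_ , _ , connected , arcs)
  D (acyclic , e , e-injective , e-arcs) u s (unavD , least) unvStar =
  -- By minimality of `u` it suffices that the claimed bound is itself an unavoidable order.
  least _ λ T tournament → decidable-stable (contains? T D) λ none →
    linear-order D acyclic λ order →
      Assembly.contained order e e-injective e-arcs tournament
        (frame q s (≤-trans (s≤s z≤n) (≤-trans 2≤n (unvStar≥order F unvStar)))
          (cong (λ m → 3 ^ (m C 2) * s) (sym (odd≡ (suc q)))) T tournament)
        connected arcs {u} unavF unvStar zero none
  where
  F⊆D : Contains D F
  F⊆D = e , e-injective , λ v w vw → trans (e-arcs v w) vw
  -- The tree inherits unavoidability from `D`; this provides the unv values of its pieces.
  unavF : Unavoidable u F
  unavF T t = contains-trans {A = T} {B = D} {G = F} (unavD T t) F⊆D
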